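{- Let $v\equiv 3\pmod 6$ with $v\ge 9$. Then there exists a $(v,3,2)$-BIBD that has an optimal weak nesting with $w=(7v+3)/6$; that is, it has a weak nesting $\phi:\mathcal{A}\to Y$ with $|Y|=(7v+3)/6$, and no weak nesting of a $(v,3,2)$-BIBD uses fewer points.
   Context: A $(v,k,\lambda)$-BIBD is a pair $(X,\mathcal{A})$ where $X$ is a set of $v$ points and $\mathcal{A}$ is a multiset of $k$-subsets of $X$ (blocks) such that every pair of distinct points lies in exactly $\lambda$ blocks. A partial $(w,k,\lambda)$-BIBD is defined in the same way on $w$ points, except that every pair lies in at most $\lambda$ blocks. Given a $(v,k,\lambda)$-BIBD $(X,\mathcal{A})$ and a set $Y\supseteq X$ with $|Y|=w$, a map $\phi:\mathcal{A}\to Y$ is a weak nesting if $\phi(A)\notin A$ for every block $A$ and the multiset $\{A\cup\{\phi(A)\}:A\in\mathcal{A}\}$ is a partial $(w,k+1,\lambda+1)$-BIBD on $Y$. A weak nesting is optimal if $w=|Y|$ is as small as possible. -}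

module Defs where

open import Data.Nat using (ℕ; suc; _≤_)
open import Data.Fin using (Fin; _≟_)
open import Data.Fin.Properties using (any?)
open import Data.Fin.Subset using (Subset; _∈_; _∉_; _∪_; ⁅_⁆; ∣_∣)
open import Data.Fin.Subset.Properties using (_∈?_)
open import Data.List using (List; length; filter; lookup; tabulate)
open import Data.List.Relation.Unary.All using (All)
import Data.Vec as Vec
open import Function.Bundles using (_↣_; Injection)
open import Relation.Binary.PropositionalEquality using (_≡_; _≢_)
open import Relation.Nullary.Decidable using (does; _×-dec_)

-- A set of n points is represented by Fin n, and a multiset of blocks by a
-- list of subsets; repeated blocks are repeated list entries.

pairCount : ∀ {n} → List (Subset n) → Fin n → Fin n → ℕ
pairCount 𝒜 x y = length (filter (λ A → (x ∈? A) ×-dec (y ∈? A)) 𝒜)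

record BIBD (v k lam : ℕ) : Set where
  field
    blocks    : List (Subset v)
    blockSize : All (λ A → ∣ A ∣ ≡ k) blocks
    balanced  : ∀ x y → x ≢ y → pairCount blocks x y ≡ lam

record IsPartialBIBD (w k lam : ℕ) (blocks : List (Subset w)) : Set where
  field
    blockSize : All (λ A → ∣ A ∣ ≡ k) blocks
    packed    : ∀ x y → x ≢ y → pairCount blocks x y ≤ lam

image : ∀ {m n} → (Fin m → Fin n) → Subset m → Subset n
image f A = Vec.tabulate (λ y → does (any? (λ x → (x ∈? A) ×-dec (f x ≟ y))))

-- The inclusion X ⊆ Y of the v points into a set of w points is an injection
-- ι.  The map φ is defined on block occurrences (positions in the list), so
-- two copies of a repeated block may receive different points.

record WeakNesting {v k lam : ℕ} (D : BIBD v k lam) (w : ℕ) : Set where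
  open BIBD D using (blocks)
  field
    ι : Fin v ↣ Fin w
    φ : Fin (length blocks) → Fin w

  embeddedBlock : Fin (length blocks) → Subset w
  embeddedBlock i = image (Injection.to ι) (lookup blocks i)

  augmentedBlocks : List (Subset w)
  augmentedBlocks = tabulate (λ i → embeddedBlock i ∪ ⁅ φ i ⁆)

  field
    φ∉block   : ∀ i → φ i ∉ embeddedBlock i
    isPartial : IsPartialBIBD w (suc k) (suc lam) augmentedBlocks

-- Minimality of w is over the weak nestings of all BIBDs with the same
-- parameters, not only those of D.

Optimal : ∀ {v k lam w} {D : BIBD v k lam} → WeakNesting D w → Set
Optimal {v} {k} {lam} {w} _ =
  ∀ (D′ : BIBD v k lam) (w′ : ℕ) → WeakNesting D′ w′ → w ≤ w′

{-# OPTIONS --safe #-}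

-- Lower bound. For a block A with centre φ(A), draw the three arcs from the points of A to φ(A);
-- there are 3b = v(v − 1) of them. A pair of points of X already lies in two blocks, so it
-- carries at most one arc, and a pair consisting of a point of X and a new point carries at
-- most three. Hence v(v − 1) ≤ v(v − 1)/2 + 3v(w − v), that is 7v ≤ 6w + 1.
--
-- Construction. Let v = 3u with u = 2s + 1, and take ℤ₃ × U with |U| = u as the point set. The
-- blocks are ordered cyclically so that every ordered pair of points is a cyclic edge of
-- exactly one of them. Given such a nested design with s + 1 new points, and an abelian group Q
-- of order 2h + 1 with an endomorphism α such that 2, α and α ± 1 are injective, a nested
-- design on ℤ₃ × Q × U consists of the copies of the old one on the fibres over Q and of the
-- blocks {(l, m − d, a), (l, m + d, b), (l + 1, m + αd, a + b)} with d ≠ 0. Of d and −d one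
-- gets the centre (l + 1, m, a − b), the other one the new point (d, a − b), which makes
-- h u + s + 1 new points. For α = 2 this allows Q = ℤₖ with k coprime to 6, and for α = i it
-- allows the field of order 9; starting with designs for u = 1 and u = 3 one reaches every
-- odd u.
module Submission where

open import Defs
open import Data.Nat as ℕ using (ℕ; suc; zero; _+_; _*_; _∸_; _≤_; _<_; _≥_; z≤n; s≤s)
open import Data.Nat.DivMod using (_/_; _%_; m≡m%n+[m/n]*n; m*n/n≡m; result; _divMod_)
import Data.Nat.Divisibility as ℕ
open import Data.Nat.Induction using (<-rec)
import Data.Nat.Properties as ℕₚ
import Data.Nat.Tactic.RingSolver as ℕ-Solver
open import Algebra.Properties.Semiring.Sum ℕₚ.+-*-semiring
  using (sum; sum-syntax; sum-cong-≗; ∑-distrib-+; ∑-comm; sum-remove; *-distribˡ-sum; *-distribʳ-sum)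
open import Data.Bool as Bool using (Bool; true; false; if_then_else_)
open import Data.Empty using (⊥; ⊥-elim)
open import Data.Fin as Fin
  using (Fin; zero; suc; toℕ; fromℕ<; punchIn; punchOut; _↑ˡ_; join; splitAt)
open import Data.Fin.Patterns
open import Data.Fin.Properties as Fin
  using ( all?; any?; toℕ-fromℕ<; toℕ-injective; toℕ<n; toℕ-cast; cast-involutive; ↑ˡ-injective
        ; splitAt-join; join-splitAt; splitAt-↑ˡ; *↔×; +↔⊎; 2↔Bool)
open import Data.Fin.Subset using (Subset; _∈_; _∉_; _∪_; ⁅_⁆; ∣_∣; _⊆_)
open import Data.Fin.Subset.Properties
  using (_∈?_; x∈p∪q⁺; x∈p∪q⁻; x∈⁅x⁆; x∈⁅y⁆⇒x≡y; ∪-identityʳ; ⊆-antisym; ∣⁅x⁆∣≡1)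
open import Data.Integer as ℤ using (ℤ)
open import Data.Integer.DivMod using (_%ℕ_; _/ℕ_; n%ℕd<d; a≡a%ℕn+[a/ℕn]*n)
open import Data.Integer.Divisibility.Signed
  using (_∣_; divides; ∣m∣n⇒∣m+n; ∣m∣n⇒∣m-n; ∣n⇒∣m*n; ∣m⇒∣m*n; ∣-refl; ∣⇒∣ᵤ)
import Data.Integer.Properties as ℤₚ
import Data.Integer.Tactic.RingSolver as ℤ-Solver
open import Data.List using (List; length; filter; tabulate; lookup)
open import Data.List.Membership.Propositional.Properties using (∈-lookup)
import Data.List.Properties as List
import Data.List.Relation.Unary.All as All
import Data.List.Relation.Unary.All.Properties as All
open import Data.Product using (Σ-syntax; ∃-syntax; _×_; _,_; proj₁; proj₂)
open import Data.Product.Function.NonDependent.Propositional using (_×-↔_)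
open import Data.Product.Properties using (≡-dec)
open import Data.Sum as Sum using (_⊎_; inj₁; inj₂)
open import Data.Sum.Function.Propositional using (_⊎-↔_)
open import Data.Sum.Properties as Sum using (inj₁-injective; inj₂-injective)
open import Data.Unit using (tt)
open import Data.Vec using ([]; _∷_; here; there)
import Data.Vec.Properties as Vec
open import Function using (_∘_; _∋_)
open import Function.Bundles using (_↔_; _↣_; Injection; mk↣)
open import Function.Construct.Composition using (_↔-∘_)
open import Function.Construct.Identity using (↔-id)
open import Function.Properties.Inverse using (↔⇒↣; ↔-sym)
open import Relation.Binary.Definitions using (DecidableEquality)
open import Relation.Binary.PropositionalEquality
open import Relation.Nullary using (Dec; ¬_; yes; no; does; contradiction)
open import Relation.Nullary.Decidable
  using (_→-dec_; _×-dec_; ¬?; from-yes; map′; True; toWitness; dec-true; dec-false)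

-- Cyclically ordered triples with centres

next : Fin 3 → Fin 3
next 0F = 1F
next 1F = 2F
next 2F = 0F

next-injective : ∀ {r r′} → next r ≡ next r′ → r ≡ r′
next-injective {0F} {0F} _ = refl
next-injective {1F} {1F} _ = refl
next-injective {2F} {2F} _ = refl
next-injective {0F} {1F} ()
next-injective {0F} {2F} ()
next-injective {1F} {0F} ()
next-injective {1F} {2F} ()

next≢ : ∀ {r} → next r ≢ r
next≢ {0F} ()
next≢ {1F} ()
next≢ {2F} ()

next²≢ : ∀ {r} → next (next r) ≢ r
next²≢ {0F} ()
next²≢ {1F} ()
next²≢ {2F} ()

-- An ordered pair of points is pt i r , pt i (next r) for at most one i, so an unordered one is
-- in at most two blocks, by its two orientations. A pair of a point and a new point may be in
-- three augmented blocks, and the slot separates these. Equality in place of "at most" follows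
-- from the number of blocks.
record NestedTriples (X N I : Set) : Set where
  field
    pt        : I → Fin 3 → X
    centre    : I → X ⊎ N
    slot      : I → Fin 3 → Fin 3
    pt-irrefl : ∀ i r → pt i r ≢ pt i (next r)
    edge-inj  : ∀ i j r r′ → pt i r ≡ pt j r′ → pt i (next r) ≡ pt j (next r′) → i ≡ j
    arc-inj   : ∀ i j r r′ {c} → centre i ≡ inj₁ c → centre j ≡ inj₁ c →
                pt i r ≡ pt j r′ → i ≡ j
    arc-asym  : ∀ i j r r′ → centre i ≡ inj₁ (pt j r′) → centre j ≢ inj₁ (pt i r)
    outer-inj : ∀ i j r r′ {ν} → centre i ≡ inj₂ ν → centre j ≡ inj₂ ν →
                pt i r ≡ pt j r′ → slot i r ≡ slot j r′ → i ≡ j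

-- Every condition forbids some coincidence, so all of them survive injective renaming of points and
-- new points and passage to a subfamily of blocks; hence the block map goes the other way.
relabel : ∀ {X N I X′ N′ I′ : Set} → X ↣ X′ → N ↣ N′ → I′ ↣ I →
          NestedTriples X N I → NestedTriples X′ N′ I′
relabel {X} {N} f g k D = record
  { pt        = λ i r → f.to (pt (k.to i) r)
  ; centre    = λ i → Sum.map f.to g.to (centre (k.to i))
  ; slot      = λ i → slot (k.to i)
  ; pt-irrefl = λ i r → pt-irrefl _ r ∘ f.injective
  ; edge-inj  = λ i j r r′ e e′ →
      k.injective (edge-inj _ _ r r′ (f.injective e) (f.injective e′))
  ; arc-inj   = λ i j r r′ e e′ eq → let c , p , q = map-inj₁ e e′ in
      k.injective (arc-inj _ _ r r′ p q (f.injective eq))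
  ; arc-asym  = λ i j r r′ e e′ → arc-asym _ _ r r′ (map-inj₁-to e) (map-inj₁-to e′)
  ; outer-inj = λ i j r r′ e e′ eq → let ν , p , q = map-inj₂ e e′ in
      k.injective ∘ outer-inj _ _ r r′ p q (f.injective eq)
  }
  where
  open NestedTriples D
  module f = Injection f
  module g = Injection g
  module k = Injection k

  map-inj₁-to : ∀ {c x} → Sum.map f.to g.to c ≡ inj₁ (f.to x) → c ≡ inj₁ x
  map-inj₁-to {inj₁ _} e = cong inj₁ (f.injective (inj₁-injective e))

  map-inj₁ : ∀ {c c′ x′} → Sum.map f.to g.to c ≡ inj₁ x′ → Sum.map f.to g.to c′ ≡ inj₁ x′ →
             Σ[ x ∈ X ] c ≡ inj₁ x × c′ ≡ inj₁ x
  map-inj₁ {inj₁ x} refl e′ = x , refl , map-inj₁-to e′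

  map-inj₂ : ∀ {c c′ ν′} → Sum.map f.to g.to c ≡ inj₂ ν′ → Sum.map f.to g.to c′ ≡ inj₂ ν′ →
             Σ[ ν ∈ N ] c ≡ inj₂ ν × c′ ≡ inj₂ ν
  map-inj₂ {inj₂ ν} {inj₂ ν″} refl e′ = ν , refl , cong inj₂ (g.injective (inj₂-injective e′))

-- S a b = a + b and T a b = a − b on an abelian group without 2-torsion.
record OrthogonalSquares (U : Set) : Set where
  field
    S T       : U → U → U
    S-cancelˡ : ∀ {a a′ b b′} → a ≡ a′ → S a b ≡ S a′ b′ → b ≡ b′
    S-cancelʳ : ∀ {a a′ b b′} → b ≡ b′ → S a b ≡ S a′ b′ → a ≡ a′
    T-cancelˡ : ∀ {a a′ b b′} → a ≡ a′ → T a b ≡ T a′ b′ → b ≡ b′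
    T-cancelʳ : ∀ {a a′ b b′} → b ≡ b′ → T a b ≡ T a′ b′ → a ≡ a′
    ST-inj    : ∀ {a a′ b b′} → S a b ≡ S a′ b′ → T a b ≡ T a′ b′ → a ≡ a′ × b ≡ b′

-- In an abelian group Q of order 2h + 1 with an endomorphism α, let ±δⱼ be the nonzero
-- elements; then place true j m and place false j m are the triples
-- (m − δ , m + δ , m + α δ) for δ = δⱼ and δ = − δⱼ.
record Frame (Q : Set) (h : ℕ) : Set where
  field
    place        : Bool → Fin h → Q → Fin 3 → Q
    place-irrefl : ∀ σ j m r → place σ j m r ≢ place σ j m (next r)
    place-edge   : ∀ {σ σ′ j j′ m m′} r → place σ j m r ≡ place σ′ j′ m′ r →
                   place σ j m (next r) ≡ place σ′ j′ m′ (next r) →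
                   (σ , j , m) ≡ (σ′ , j′ , m′)
    place-m      : ∀ {j j′ m m′} r → j ≡ j′ → place false j m r ≡ place false j′ m′ r → m ≡ m′
    place-j      : ∀ {j j′ m m′} r → m ≡ m′ → place true j m r ≡ place true j′ m′ r → j ≡ j′
    place≢m      : ∀ {j m} r → place true j m r ≢ m
    place-opp    : ∀ {j j′ m m′} → m ≡ m′ → place true j m 0F ≢ place true j′ m′ 1F
    place-asym   : ∀ {j j′ m m′} → place true j m 2F ≡ m′ → place true j′ m′ 2F ≢ m

-- Inflating a nested design by a frame

module Inflation {Q U N I : Set} {h : ℕ}
                 (F : Frame Q h) (L : OrthogonalSquares U) (D : NestedTriples (Fin 3 × U) N I)
                 where
  open Frame F
  open OrthogonalSquares L
  private module D = NestedTriples D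

  Point Outer Cross Index : Set
  Point = Fin 3 × Q × U
  Outer = Fin h × U ⊎ N
  Cross = (Bool × Fin h × Q) × Fin 3 × U × U
  Index = Cross ⊎ Q × I

  put : Q → Fin 3 × U → Point
  put q (l , x) = l , q , x

  crossPt : Cross → Fin 3 → Point
  crossPt ((σ , j , m) , l , a , b) 0F = l , place σ j m 0F , a
  crossPt ((σ , j , m) , l , a , b) 1F = l , place σ j m 1F , b
  crossPt ((σ , j , m) , l , a , b) 2F = next l , place σ j m 2F , S a b

  crossCentre : Cross → Point ⊎ Outer
  crossCentre ((true  , j , m) , l , a , b) = inj₁ (next l , m , T a b)
  crossCentre ((false , j , m) , l , a , b) = inj₂ (inj₁ (j , T a b))

  pt : Index → Fin 3 → Point
  pt (inj₁ c)       r = crossPt c r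
  pt (inj₂ (q , i)) r = put q (D.pt i r)

  fillCentre : Q → (Fin 3 × U) ⊎ N → Point ⊎ Outer
  fillCentre q = Sum.map (put q) inj₂

  centre : Index → Point ⊎ Outer
  centre (inj₁ c)       = crossCentre c
  centre (inj₂ (q , i)) = fillCentre q (D.centre i)

  -- Among the crossing blocks with a given new point as centre, a point occurs at most once in each
  -- position, so the position itself can serve as the slot.
  slot : Index → Fin 3 → Fin 3
  slot (inj₁ c)       r = r
  slot (inj₂ (q , i)) r = D.slot i r

  level : Point → Fin 3
  level = proj₁

  site : Point → Q
  site = proj₁ ∘ proj₂

  fibre : Point → U
  fibre = proj₂ ∘ proj₂

  unput : ∀ {q q′ z z′} → put q z ≡ put q′ z′ → z ≡ z′
  unput refl = refl

  site-put : ∀ {q q′ z z′} → put q z ≡ put q′ z′ → q ≡ q′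
  site-put refl = refl

  crossSite : ∀ σ j m l a b r → site (crossPt ((σ , j , m) , l , a , b) r) ≡ place σ j m r
  crossSite σ j m l a b 0F = refl
  crossSite σ j m l a b 1F = refl
  crossSite σ j m l a b 2F = refl

  Cross-≡ : ∀ {d d′ l l′ a a′ b b′} → d ≡ d′ → l ≡ l′ → a ≡ a′ → b ≡ b′ →
            _≡_ {A = Index} (inj₁ (d , l , a , b)) (inj₁ (d′ , l′ , a′ , b′))
  Cross-≡ refl refl refl refl = refl

  -- This separates the two kinds of blocks: a filling block lies over a single site, a crossing
  -- block never has two points over the same one.
  crossIrrefl : ∀ c r → site (crossPt c r) ≢ site (crossPt c (next r))
  crossIrrefl ((σ , j , m) , _) 0F = place-irrefl σ j m 0F
  crossIrrefl ((σ , j , m) , _) 1F = place-irrefl σ j m 1F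
  crossIrrefl ((σ , j , m) , _) 2F = place-irrefl σ j m 2F

  pt-irrefl : ∀ i r → pt i r ≢ pt i (next r)
  pt-irrefl (inj₁ c)       r = crossIrrefl c r ∘ cong site
  pt-irrefl (inj₂ (q , i)) r = D.pt-irrefl i r ∘ unput

  -- Along the three edges of a crossing block the level changes by 0, 1 and -1, which determines
  -- the position. The frame then recovers σ, j, m, and cancellation in `S` the fibre coordinates.
  edge-inj : ∀ i j r r′ → pt i r ≡ pt j r′ → pt i (next r) ≡ pt j (next r′) → i ≡ j
  edge-inj (inj₁ _) (inj₁ _) 0F 0F e e′ =
    Cross-≡ (place-edge 0F (cong site e) (cong site e′))
            (cong level e) (cong fibre e) (cong fibre e′)
  edge-inj (inj₁ _) (inj₁ _) 0F 1F e e′ =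
    ⊥-elim (next≢ (trans (sym (cong level e′)) (cong level e)))
  edge-inj (inj₁ _) (inj₁ _) 0F 2F e e′ =
    ⊥-elim (next≢ (trans (sym (cong level e)) (cong level e′)))
  edge-inj (inj₁ _) (inj₁ _) 1F 0F e e′ =
    ⊥-elim (next≢ (trans (cong level e′) (sym (cong level e))))
  edge-inj (inj₁ _) (inj₁ _) 1F 1F e e′ =
    Cross-≡ (place-edge 1F (cong site e) (cong site e′))
            (cong level e) (S-cancelʳ (cong fibre e) (cong fibre e′)) (cong fibre e)
  edge-inj (inj₁ _) (inj₁ _) 1F 2F e e′ =
    ⊥-elim (next²≢ (trans (cong next (sym (cong level e))) (cong level e′)))
  edge-inj (inj₁ _) (inj₁ _) 2F 0F e e′ =
    ⊥-elim (next≢ (trans (cong level e) (sym (cong level e′))))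
  edge-inj (inj₁ _) (inj₁ _) 2F 1F e e′ =
    ⊥-elim (next²≢ (trans (cong next (cong level e)) (sym (cong level e′))))
  edge-inj (inj₁ _) (inj₁ _) 2F 2F e e′ =
    Cross-≡ (place-edge 2F (cong site e) (cong site e′))
            (cong level e′) (cong fibre e′) (S-cancelˡ (cong fibre e′) (cong fibre e))
  edge-inj (inj₁ c) (inj₂ _) r r′ e e′ =
    ⊥-elim (crossIrrefl c r (trans (cong site e) (sym (cong site e′))))
  edge-inj (inj₂ _) (inj₁ c) r r′ e e′ =
    ⊥-elim (crossIrrefl c r′ (trans (sym (cong site e)) (cong site e′)))
  edge-inj (inj₂ (q , i)) (inj₂ (q′ , i′)) r r′ e e′ =
    cong inj₂ (cong₂ _,_ (site-put e) (D.edge-inj i i′ r r′ (unput e) (unput e′)))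

  fillCentre₁ : ∀ q c {z} → fillCentre q c ≡ inj₁ z →
                Σ[ y ∈ Fin 3 × U ] c ≡ inj₁ y × put q y ≡ z
  fillCentre₁ q (inj₁ y) refl = y , refl , refl

  fillCentre₂ : ∀ q c {ν} → fillCentre q c ≡ inj₂ ν →
                Σ[ μ ∈ N ] c ≡ inj₂ μ × inj₂ μ ≡ ν
  fillCentre₂ q (inj₂ μ) refl = μ , refl , refl

  -- The centre lies over m, and `place≢m` keeps the points of the block off m. In a filling block
  -- an old centre has the same site as the points, so no arc of one kind equals or reverses an arc
  -- of the other.
  crossCentreSite : ∀ c r {z} → crossCentre c ≡ inj₁ z → site (crossPt c r) ≢ site z
  crossCentreSite ((true , j , m) , l , a , b) r refl e =
    place≢m r (trans (sym (crossSite true j m l a b r)) e)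

  -- A common centre fixes l, m and a - b. The level separates position `2F` from the others, and
  -- `place-opp` separates `0F` from `1F`. In a given position `place-j` yields j, and the fibre
  -- coordinate together with a - b yields a and b; for `2F` this is where orthogonality enters.
  crossArc : ∀ c c′ r r′ {z} → crossCentre c ≡ inj₁ z → crossCentre c′ ≡ inj₁ z →
             crossPt c r ≡ crossPt c′ r′ → inj₁ c ≡ (Index ∋ inj₁ c′)
  crossArc ((true , j , m) , l , a , b) ((true , j′ , m′) , l′ , a′ , b′) r r′ refl e′ =
      go r r′
    where
    m≡ = cong site (inj₁-injective (sym e′))
    l≡ = next-injective (cong level (inj₁-injective (sym e′)))
    T≡ = cong fibre (inj₁-injective (sym e′))
    d≡ : j ≡ j′ → (true , j , m) ≡ (true , j′ , m′)
    d≡ refl = cong (λ m → true , j , m) m≡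
    go : ∀ r r′ → crossPt ((true , j , m) , l , a , b) r ≡ crossPt ((true , j′ , m′) , l′ , a′ , b′) r′ →
         inj₁ ((true , j , m) , l , a , b) ≡ (Index ∋ inj₁ ((true , j′ , m′) , l′ , a′ , b′))
    go 0F 0F e = Cross-≡ (d≡ (place-j 0F m≡ (cong site e))) l≡ (cong fibre e)
                         (T-cancelˡ (cong fibre e) T≡)
    go 1F 1F e = Cross-≡ (d≡ (place-j 1F m≡ (cong site e))) l≡
                         (T-cancelʳ (cong fibre e) T≡) (cong fibre e)
    go 2F 2F e = let p , q = ST-inj (cong fibre e) T≡ in
                 Cross-≡ (d≡ (place-j 2F m≡ (cong site e))) l≡ p q
    go 0F 1F e = ⊥-elim (place-opp m≡ (cong site e))
    go 1F 0F e = ⊥-elim (place-opp (sym m≡) (cong site (sym e)))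
    go 0F 2F e = ⊥-elim (next≢ (trans (sym (cong level e)) l≡))
    go 1F 2F e = ⊥-elim (next≢ (trans (sym (cong level e)) l≡))
    go 2F 0F e = ⊥-elim (next≢ (trans (cong level e) (sym l≡)))
    go 2F 1F e = ⊥-elim (next≢ (trans (cong level e) (sym l≡)))

  arc-inj : ∀ i j r r′ {c} → centre i ≡ inj₁ c → centre j ≡ inj₁ c → pt i r ≡ pt j r′ → i ≡ j
  arc-inj (inj₁ c) (inj₁ c′) r r′ e e′ eq = crossArc c c′ r r′ e e′ eq
  arc-inj (inj₁ c) (inj₂ (q , i)) r r′ e e′ eq with fillCentre₁ q (D.centre i) e′
  ... | _ , _ , refl = ⊥-elim (crossCentreSite c r e (cong site eq))
  arc-inj (inj₂ (q , i)) (inj₁ c) r r′ e e′ eq with fillCentre₁ q (D.centre i) e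
  ... | _ , _ , refl = ⊥-elim (crossCentreSite c r′ e′ (cong site (sym eq)))
  arc-inj (inj₂ (q , i)) (inj₂ (q′ , i′)) r r′ e e′ eq
    with fillCentre₁ q (D.centre i) e | fillCentre₁ q′ (D.centre i′) e′
  ... | _ , p , refl | _ , p′ , refl =
    cong inj₂ (cong₂ _,_ (site-put eq) (D.arc-inj i i′ r r′ p p′ (unput eq)))

  -- Arcs run from level l or l + 1 to level l + 1, so two opposite arcs must stay on one level and
  -- both start in position `2F`. Then m′ = m + αδ and m = m′ + αδ′, which `place-asym` excludes.
  crossAsym : ∀ c c′ r r′ → crossCentre c ≡ inj₁ (crossPt c′ r′) →
              crossCentre c′ ≢ inj₁ (crossPt c r)
  crossAsym ((true , j , m) , l , a , b) ((true , j′ , m′) , l′ , a′ , b′) r r′ e e′ =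
      go r r′ (inj₁-injective e) (inj₁-injective e′)
    where
    up : Point
    up = next l , m , T a b
    up′ : Point
    up′ = next l′ , m′ , T a′ b′
    go : ∀ r r′ → up ≡ crossPt ((true , j′ , m′) , l′ , a′ , b′) r′ →
         up′ ≢ crossPt ((true , j , m) , l , a , b) r
    twist : next l ≡ l′ → next l′ ≢ l
    twist p q = next²≢ (trans (cong next p) q)
    bend : next l ≡ l′ → next l′ ≢ next l
    bend p q = next≢ (trans q p)
    bend′ : next l ≡ next l′ → next l′ ≢ l
    bend′ p q = next≢ (trans p q)
    go 0F 0F e e′ = twist (cong level e) (cong level e′)
    go 0F 1F e e′ = twist (cong level e) (cong level e′)
    go 1F 0F e e′ = twist (cong level e) (cong level e′)
    go 1F 1F e e′ = twist (cong level e) (cong level e′)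
    go 2F 0F e e′ = bend (cong level e) (cong level e′)
    go 2F 1F e e′ = bend (cong level e) (cong level e′)
    go 0F 2F e e′ = bend′ (cong level e) (cong level e′)
    go 1F 2F e e′ = bend′ (cong level e) (cong level e′)
    go 2F 2F e e′ = place-asym (sym (cong site e′)) (sym (cong site e))

  arc-asym : ∀ i j r r′ → centre i ≡ inj₁ (pt j r′) → centre j ≢ inj₁ (pt i r)
  arc-asym (inj₁ c) (inj₁ c′) r r′ e e′ = crossAsym c c′ r r′ e e′
  arc-asym (inj₁ c) (inj₂ (q , i)) r r′ e e′ with fillCentre₁ q (D.centre i) e′
  ... | _ , _ , p = crossCentreSite c r e (sym (cong site p))
  arc-asym (inj₂ (q , i)) (inj₁ c) r r′ e e′ with fillCentre₁ q (D.centre i) e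
  ... | _ , _ , p = crossCentreSite c r′ e′ (sym (cong site p))
  arc-asym (inj₂ (q , i)) (inj₂ (q′ , i′)) r r′ e e′
    with fillCentre₁ q (D.centre i) e | fillCentre₁ q′ (D.centre i′) e′
  ... | _ , p , s | _ , p′ , s′ =
    D.arc-asym i i′ r r′ (trans p (cong inj₁ (unput s))) (trans p′ (cong inj₁ (unput s′)))

  -- The new point fixes j and a - b but not m or l. With the position known from the slot,
  -- `place-m` recovers m and the level recovers l.
  crossOuter : ∀ c c′ r r′ {ν} → crossCentre c ≡ inj₂ ν → crossCentre c′ ≡ inj₂ ν →
               crossPt c r ≡ crossPt c′ r′ → r ≡ r′ → inj₁ c ≡ (Index ∋ inj₁ c′)
  crossOuter ((false , j , m) , l , a , b) ((false , j′ , m′) , l′ , a′ , b′) r r′ refl e′ =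
      go r r′
    where
    j≡ = cong proj₁ (inj₁-injective (inj₂-injective (sym e′)))
    T≡ = cong proj₂ (inj₁-injective (inj₂-injective (sym e′)))
    d≡ : m ≡ m′ → (false , j , m) ≡ (false , j′ , m′)
    d≡ refl = cong (λ j → false , j , m) j≡
    go : ∀ r r′ → crossPt ((false , j , m) , l , a , b) r ≡ crossPt ((false , j′ , m′) , l′ , a′ , b′) r′ →
         r ≡ r′ → inj₁ ((false , j , m) , l , a , b) ≡ (Index ∋ inj₁ ((false , j′ , m′) , l′ , a′ , b′))
    go 0F 0F e _ = Cross-≡ (d≡ (place-m 0F j≡ (cong site e))) (cong level e) (cong fibre e)
                           (T-cancelˡ (cong fibre e) T≡)
    go 1F 1F e _ = Cross-≡ (d≡ (place-m 1F j≡ (cong site e))) (cong level e)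
                           (T-cancelʳ (cong fibre e) T≡) (cong fibre e)
    go 2F 2F e _ = let p , q = ST-inj (cong fibre e) T≡ in
                   Cross-≡ (d≡ (place-m 2F j≡ (cong site e))) (next-injective (cong level e)) p q

  outer-inj : ∀ i j r r′ {ν} → centre i ≡ inj₂ ν → centre j ≡ inj₂ ν →
              pt i r ≡ pt j r′ → slot i r ≡ slot j r′ → i ≡ j
  outer-inj (inj₁ c) (inj₁ c′) r r′ e e′ eq s = crossOuter c c′ r r′ e e′ eq s
  outer-inj (inj₁ ((false , _) , _)) (inj₂ (q , i)) r r′ refl e′ eq s with fillCentre₂ q (D.centre i) e′
  ... | _ , _ , ()
  outer-inj (inj₂ (q , i)) (inj₁ ((false , _) , _)) r r′ e refl eq s with fillCentre₂ q (D.centre i) e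
  ... | _ , _ , ()
  outer-inj (inj₂ (q , i)) (inj₂ (q′ , i′)) r r′ e e′ eq s
    with fillCentre₂ q (D.centre i) e | fillCentre₂ q′ (D.centre i′) e′
  ... | _ , p , refl | _ , p′ , refl =
    cong inj₂ (cong₂ _,_ (site-put eq) (D.outer-inj i i′ r r′ p p′ (unput eq) s))

  inflate : NestedTriples Point Outer Index
  inflate = record
    { pt = pt ; centre = centre ; slot = slot ; pt-irrefl = pt-irrefl ; edge-inj = edge-inj
    ; arc-inj = arc-inj ; arc-asym = arc-asym ; outer-inj = outer-inj }

-- Frames and orthogonal squares from residues

module Residues (h : ℕ) where
  open import Data.Integer using (+_)

  k : ℕ
  k = suc (2 * h)

  infix 4 _≈_
  record _≈_ (x y : ℤ) : Set where
    constructor congruent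
    field divisible : + k ∣ x ℤ.- y
  open _≈_

  ⟦_⟧ : Fin k → ℤ
  ⟦ m ⟧ = + toℕ m

  opaque
    residue : ℤ → Fin k
    residue x = fromℕ< (n%ℕd<d x k)

    residue-≈ : ∀ x → ⟦ residue x ⟧ ≈ x
    residue-≈ x = congruent (divides (ℤ.- (x /ℕ k)) (begin
      ⟦ residue x ⟧ ℤ.- x                             ≡⟨ cong (λ n → + n ℤ.- x) (toℕ-fromℕ< _) ⟩
      + (x %ℕ k) ℤ.- x                                ≡⟨ cong (λ y → + (x %ℕ k) ℤ.- y) (a≡a%ℕn+[a/ℕn]*n x k) ⟩
      + (x %ℕ k) ℤ.- (+ (x %ℕ k) ℤ.+ (x /ℕ k) ℤ.* + k) ≡⟨ lemma (+ (x %ℕ k)) (x /ℕ k) (+ k) ⟩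
      ℤ.- (x /ℕ k) ℤ.* + k                            ∎))
      where
      open ≡-Reasoning
      lemma : ∀ r q d → r ℤ.- (r ℤ.+ q ℤ.* d) ≡ ℤ.- q ℤ.* d
      lemma = ℤ-Solver.solve-∀

  ≈-trans : ∀ {x y z} → x ≈ y → y ≈ z → x ≈ z
  ≈-trans {x} {y} {z} (congruent p) (congruent q) =
    congruent (subst (+ k ∣_) (lemma x y z) (∣m∣n⇒∣m+n p q))
    where
    lemma : ∀ x y z → (x ℤ.- y) ℤ.+ (y ℤ.- z) ≡ x ℤ.- z
    lemma = ℤ-Solver.solve-∀

  ≈-sym : ∀ {x y} → x ≈ y → y ≈ x
  ≈-sym {x} {y} (congruent p) = congruent (subst (+ k ∣_) (lemma x y) (∣n⇒∣m*n (ℤ.- + 1) p))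
    where
    lemma : ∀ x y → ℤ.- + 1 ℤ.* (x ℤ.- y) ≡ y ℤ.- x
    lemma = ℤ-Solver.solve-∀

  ≡⇒≈ : ∀ {x y} → x ≡ y → x ≈ y
  ≡⇒≈ {x} refl = congruent (divides (+ 0) (ℤₚ.+-inverseʳ x))

  residue⇒≈ : ∀ {x y} → residue x ≡ residue y → x ≈ y
  residue⇒≈ {x} {y} e =
    ≈-trans (≈-sym (residue-≈ x)) (≈-trans (≡⇒≈ (cong ⟦_⟧ e)) (residue-≈ y))

  residue≡⇒≈ : ∀ {x m} → residue x ≡ m → x ≈ ⟦ m ⟧
  residue≡⇒≈ {x} refl = ≈-sym (residue-≈ x)

  -- A multiple of k of absolute value less than k is 0.
  ≈⇒≡ : ∀ {x y} → ℤ.∣ x ℤ.- y ∣ < k → x ≈ y → x ≡ y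
  ≈⇒≡ {x} {y} lt (congruent p) = ℤₚ.i-j≡0⇒i≡j x y (ℤₚ.∣i∣≡0⇒i≡0 (small lt (∣⇒∣ᵤ p)))
    where
    small : ∀ {n} → n < k → k ℕ.∣ n → n ≡ 0
    small {zero}  _  _ = refl
    small {suc n} lt d = ⊥-elim (ℕ.>⇒∤ lt d)

  ⟦⟧-injective : ∀ {m m′} → ⟦ m ⟧ ≈ ⟦ m′ ⟧ → m ≡ m′
  ⟦⟧-injective {m} {m′} p = toℕ-injective (ℤₚ.+-injective (≈⇒≡ bound p))
    where
    bound : ℤ.∣ ⟦ m ⟧ ℤ.- ⟦ m′ ⟧ ∣ < k
    bound = subst (_< k) (cong ℤ.∣_∣ (sym (ℤₚ.m-n≡m⊖n (toℕ m) (toℕ m′))))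
              (ℕₚ.≤-<-trans (ℤₚ.∣m⊝n∣≤m⊔n (toℕ m) (toℕ m′)) (ℕₚ.⊔-lub (toℕ<n m) (toℕ<n m′)))

  ≈-cancelˡ : ∀ {a a′ x x′} → a ≡ a′ → a ℤ.+ x ≈ a′ ℤ.+ x′ → x ≈ x′
  ≈-cancelˡ {a} {x = x} {x′} refl (congruent p) = congruent (subst (+ k ∣_) (lemma a x x′) p)
    where
    lemma : ∀ a x y → (a ℤ.+ x) ℤ.- (a ℤ.+ y) ≡ x ℤ.- y
    lemma = ℤ-Solver.solve-∀

  ≈-cancelʳ : ∀ {a a′ x x′} → a ≡ a′ → x ℤ.+ a ≈ x′ ℤ.+ a′ → x ≈ x′
  ≈-cancelʳ {a} {x = x} {x′} refl (congruent p) = congruent (subst (+ k ∣_) (lemma a x x′) p)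
    where
    lemma : ∀ a x y → (x ℤ.+ a) ℤ.- (y ℤ.+ a) ≡ x ℤ.- y
    lemma = ℤ-Solver.solve-∀

  ≈-neg : ∀ {x x′} → ℤ.- x ≈ ℤ.- x′ → x ≈ x′
  ≈-neg {x} {x′} (congruent p) = ≈-sym (congruent (subst (+ k ∣_) (lemma x x′) p))
    where
    lemma : ∀ x y → ℤ.- x ℤ.- ℤ.- y ≡ y ℤ.- x
    lemma = ℤ-Solver.solve-∀

  -- As k = 2h + 1, x = k x - h (2x).
  halve : ∀ {x} → + k ∣ + 2 ℤ.* x → + k ∣ x
  halve {x} p = subst (+ k ∣_) eq (∣m∣n⇒∣m-n (∣m⇒∣m*n x (∣-refl {+ k})) (∣n⇒∣m*n (+ h) p))
    where
    lemma : ∀ h x → (+ 1 ℤ.+ + 2 ℤ.* h) ℤ.* x ℤ.- h ℤ.* (+ 2 ℤ.* x) ≡ x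
    lemma = ℤ-Solver.solve-∀
    k≡ : + k ≡ + 1 ℤ.+ + 2 ℤ.* + h
    k≡ = cong (λ y → + 1 ℤ.+ y) (ℤₚ.pos-* 2 h)
    eq : + k ℤ.* x ℤ.- + h ℤ.* (+ 2 ℤ.* x) ≡ x
    eq = trans (cong (λ n → n ℤ.* x ℤ.- + h ℤ.* (+ 2 ℤ.* x)) k≡) (lemma (+ h) x)

  squares : OrthogonalSquares (Fin k)
  squares = record
    { S = λ a b → residue (⟦ a ⟧ ℤ.+ ⟦ b ⟧)
    ; T = λ a b → residue (⟦ a ⟧ ℤ.- ⟦ b ⟧)
    ; S-cancelˡ = λ e p → ⟦⟧-injective (≈-cancelˡ (cong ⟦_⟧ e) (residue⇒≈ p))
    ; S-cancelʳ = λ e p → ⟦⟧-injective (≈-cancelʳ (cong ⟦_⟧ e) (residue⇒≈ p))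
    ; T-cancelˡ = λ e p → ⟦⟧-injective (≈-neg (≈-cancelˡ (cong ⟦_⟧ e) (residue⇒≈ p)))
    ; T-cancelʳ = λ e p → ⟦⟧-injective (≈-cancelʳ (cong (λ b → ℤ.- ⟦ b ⟧) e) (residue⇒≈ p))
    -- The sum and the difference of the two congruences are 2(a - a′) and 2(b - b′).
    ; ST-inj = λ {a} {a′} {b} {b′} p q →
        let p′ = divisible (residue⇒≈ p) ; q′ = divisible (residue⇒≈ q) in
        ⟦⟧-injective (congruent (halve (subst (+ k ∣_) (plus ⟦ a ⟧ ⟦ a′ ⟧ ⟦ b ⟧ ⟦ b′ ⟧) (∣m∣n⇒∣m+n p′ q′)))) ,
        ⟦⟧-injective (congruent (halve (subst (+ k ∣_) (minus ⟦ a ⟧ ⟦ a′ ⟧ ⟦ b ⟧ ⟦ b′ ⟧) (∣m∣n⇒∣m-n p′ q′))))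
    }
    where
    plus : ∀ a a′ b b′ → ((a ℤ.+ b) ℤ.- (a′ ℤ.+ b′)) ℤ.+ ((a ℤ.- b) ℤ.- (a′ ℤ.- b′)) ≡
           + 2 ℤ.* (a ℤ.- a′)
    plus = ℤ-Solver.solve-∀
    minus : ∀ a a′ b b′ → ((a ℤ.+ b) ℤ.- (a′ ℤ.+ b′)) ℤ.- ((a ℤ.- b) ℤ.- (a′ ℤ.- b′)) ≡
            + 2 ℤ.* (b ℤ.- b′)
    minus = ℤ-Solver.solve-∀

  module _ (invert6 : ∀ {x} → + k ∣ + 6 ℤ.* x → + k ∣ x) where

    -- The multipliers -1, 1, 2 of δ and their cyclic differences 2, 1, -3 all divide 6, so
    -- cancelling 6 modulo k is enough to cancel each of them; d is the complementary factor.
    invert : ∀ {x y z} c d → d ℤ.* c ≡ + 6 → z ≡ c ℤ.* (x ℤ.- y) → + k ∣ z → x ≈ y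
    invert {x} {y} c d e refl p = congruent (invert6 (subst (+ k ∣_)
      (trans (sym (ℤₚ.*-assoc d c (x ℤ.- y))) (cong (ℤ._* (x ℤ.- y)) e)) (∣n⇒∣m*n d p)))

    δ : Bool → Fin h → ℤ
    δ true  j = + suc (toℕ j)
    δ false j = ℤ.- + suc (toℕ j)

    ∣δ∣≤h : ∀ σ j → ℤ.∣ δ σ j ∣ ≤ h
    ∣δ∣≤h true  j = toℕ<n j
    ∣δ∣≤h false j = toℕ<n j

    δ≉0 : ∀ σ j → ¬ δ σ j ≈ + 0
    δ≉0 σ j p = nonzero σ j (≈⇒≡ bound p)
      where
      bound : ℤ.∣ δ σ j ℤ.- + 0 ∣ < k
      bound = s≤s (ℕₚ.≤-trans (ℕₚ.≤-reflexive (cong ℤ.∣_∣ (ℤₚ.+-identityʳ (δ σ j))))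
                    (ℕₚ.≤-trans (∣δ∣≤h σ j) (ℕₚ.m≤m+n h (h + 0))))
      nonzero : ∀ σ j → δ σ j ≢ + 0
      nonzero true  j ()
      nonzero false j ()

    -- Two representatives differ by at most 2h < k in absolute value.
    δ-≈⇒≡ : ∀ {σ σ′ j j′} → δ σ j ≈ δ σ′ j′ → δ σ j ≡ δ σ′ j′
    δ-≈⇒≡ {σ} {σ′} {j} {j′} = ≈⇒≡ (s≤s (ℕₚ.≤-trans (ℤₚ.∣i-j∣≤∣i∣+∣j∣ (δ σ j) (δ σ′ j′))
      (ℕₚ.+-mono-≤ (∣δ∣≤h σ j) (ℕₚ.≤-trans (∣δ∣≤h σ′ j′) (ℕₚ.m≤m+n h 0)))))

    δ-injective : ∀ {σ σ′ j j′} → δ σ j ≡ δ σ′ j′ → (σ , j) ≡ (σ′ , j′)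
    δ-injective {true}  {true}  e = cong (true ,_) (toℕ-injective (ℕₚ.suc-injective (ℤₚ.+-injective e)))
    δ-injective {false} {false} e = cong (false ,_) (toℕ-injective (ℤₚ.-[1+-injective e))

    δ-true≢false : ∀ {j j′} → δ true j ≢ δ false j′
    δ-true≢false ()

    -- `coeff` lists the multipliers of δ for α = 2. The other two complete the cyclic differences
    -- and the multipliers to 6.
    coeff stepInv coeffInv : Fin 3 → ℤ
    coeff 0F = ℤ.- + 1
    coeff 1F = + 1
    coeff 2F = + 2
    stepInv 0F = + 3
    stepInv 1F = + 6
    stepInv 2F = ℤ.- + 2
    coeffInv 0F = ℤ.- + 6
    coeffInv 1F = + 6
    coeffInv 2F = + 3

    step : Fin 3 → ℤ
    step r = coeff (next r) ℤ.- coeff r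

    stepInv-* : ∀ r → stepInv r ℤ.* step r ≡ + 6
    stepInv-* 0F = refl
    stepInv-* 1F = refl
    stepInv-* 2F = refl

    coeffInv-* : ∀ r → coeffInv r ℤ.* coeff r ≡ + 6
    coeffInv-* 0F = refl
    coeffInv-* 1F = refl
    coeffInv-* 2F = refl

    at : ℤ → Fin k → Fin 3 → ℤ
    at d m r = ⟦ m ⟧ ℤ.+ coeff r ℤ.* d

    place : Bool → Fin h → Fin k → Fin 3 → Fin k
    place σ j m r = residue (at (δ σ j) m r)

    -- Subtracting the congruences for consecutive positions eliminates m and m′ and leaves (c′ -
    -- c)(d - d′).
    at-step : ∀ {d d′ m m′} r → at d m r ≈ at d′ m′ r → at d m (next r) ≈ at d′ m′ (next r) → d ≈ d′
    at-step {d} {d′} {m} {m′} r (congruent p) (congruent q) =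
      invert (step r) (stepInv r) (stepInv-* r)
        (lemma ⟦ m ⟧ ⟦ m′ ⟧ (coeff r) (coeff (next r)) d d′) (∣m∣n⇒∣m-n q p)
      where
      lemma : ∀ m m′ c c′ d d′ → ((m ℤ.+ c′ ℤ.* d) ℤ.- (m′ ℤ.+ c′ ℤ.* d′)) ℤ.-
              ((m ℤ.+ c ℤ.* d) ℤ.- (m′ ℤ.+ c ℤ.* d′)) ≡ (c′ ℤ.- c) ℤ.* (d ℤ.- d′)
      lemma = ℤ-Solver.solve-∀

    at-m : ∀ {d d′ m m′} r → d ≡ d′ → at d m r ≈ at d′ m′ r → m ≡ m′
    at-m {d} r refl p = ⟦⟧-injective (≈-cancelʳ {coeff r ℤ.* d} refl p)

    at-δ : ∀ {d d′ m m′} r → m ≡ m′ → at d m r ≈ at d′ m′ r → d ≈ d′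
    at-δ {d} {d′} {m} r refl (congruent p) =
      invert (coeff r) (coeffInv r) (coeffInv-* r) (lemma ⟦ m ⟧ (coeff r) d d′) p
      where
      lemma : ∀ m c d d′ → (m ℤ.+ c ℤ.* d) ℤ.- (m ℤ.+ c ℤ.* d′) ≡ c ℤ.* (d ℤ.- d′)
      lemma = ℤ-Solver.solve-∀

    at-next : ∀ {d m} r → at d m r ≈ at d m (next r) → d ≈ + 0
    at-next {d} {m} r p = invert (step r) (stepInv r) (stepInv-* r)
      (lemma ⟦ m ⟧ (coeff r) (coeff (next r)) d) (divisible (≈-sym p))
      where
      lemma : ∀ m c c′ d → (m ℤ.+ c′ ℤ.* d) ℤ.- (m ℤ.+ c ℤ.* d) ≡ (c′ ℤ.- c) ℤ.* (d ℤ.- + 0)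
      lemma = ℤ-Solver.solve-∀

    at-centre : ∀ {d m} r → at d m r ≈ ⟦ m ⟧ → d ≈ + 0
    at-centre {d} {m} r (congruent p) =
      invert (coeff r) (coeffInv r) (coeffInv-* r) (lemma ⟦ m ⟧ (coeff r) d) p
      where
      lemma : ∀ m c d → (m ℤ.+ c ℤ.* d) ℤ.- m ≡ c ℤ.* (d ℤ.- + 0)
      lemma = ℤ-Solver.solve-∀

    at-opp : ∀ {d d′ m m′} → m ≡ m′ → at d m 0F ≈ at d′ m′ 1F → d ≈ ℤ.- d′
    at-opp {d} {d′} {m} refl (congruent p) =
      invert (ℤ.- + 1) (ℤ.- + 6) refl (lemma ⟦ m ⟧ d d′) p
      where
      lemma : ∀ m d d′ → (m ℤ.+ ℤ.- + 1 ℤ.* d) ℤ.- (m ℤ.+ + 1 ℤ.* d′) ≡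
              ℤ.- + 1 ℤ.* (d ℤ.- ℤ.- d′)
      lemma = ℤ-Solver.solve-∀

    -- Adding the two congruences eliminates m and m′ and leaves 2(d + d′).
    at-asym : ∀ {d d′ m m′} → at d m 2F ≈ ⟦ m′ ⟧ → at d′ m′ 2F ≈ ⟦ m ⟧ → d ≈ ℤ.- d′
    at-asym {d} {d′} {m} {m′} (congruent p) (congruent q) =
      invert (+ 2) (+ 3) refl (lemma ⟦ m ⟧ ⟦ m′ ⟧ d d′) (∣m∣n⇒∣m+n p q)
      where
      lemma : ∀ m m′ d d′ → ((m ℤ.+ + 2 ℤ.* d) ℤ.- m′) ℤ.+ ((m′ ℤ.+ + 2 ℤ.* d′) ℤ.- m) ≡
              + 2 ℤ.* (d ℤ.- ℤ.- d′)
      lemma = ℤ-Solver.solve-∀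

    frame : Frame (Fin k) h
    frame = record
      { place        = place
      ; place-irrefl = λ σ j m r e → δ≉0 σ j (at-next {m = m} r (residue⇒≈ e))
      ; place-edge   = λ {σ} {σ′} r e e′ → edge {σ} {σ′} r (residue⇒≈ e) (residue⇒≈ e′)
      ; place-m      = λ r j≡ e → at-m r (cong (δ false) j≡) (residue⇒≈ e)
      ; place-j      = λ {_} {_} {m} {m′} r m≡ e →
          cong proj₂ (δ-injective {true} {true} (δ-≈⇒≡ {true} {true} (at-δ {m = m} {m′} r m≡ (residue⇒≈ e))))
      ; place≢m      = λ {j} {m} r e → δ≉0 true j (at-centre {m = m} r (residue≡⇒≈ e))
      -- The negative of `δ true j′` is `δ false j′`, and representatives of opposite sign are never
      -- congruent.
      ; place-opp    = λ {j} {j′} {m} {m′} m≡ e →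
          δ-true≢false {j} {j′} (δ-≈⇒≡ {true} {false} (at-opp {m = m} {m′} m≡ (residue⇒≈ e)))
      ; place-asym   = λ {j} {j′} {m} {m′} e e′ →
          δ-true≢false {j} {j′} (δ-≈⇒≡ {true} {false}
            (at-asym {m = m} {m′} (residue≡⇒≈ e) (residue≡⇒≈ e′)))
      }
      where
      edge : ∀ {σ σ′ j j′ m m′} r → at (δ σ j) m r ≈ at (δ σ′ j′) m′ r →
             at (δ σ j) m (next r) ≈ at (δ σ′ j′) m′ (next r) → (σ , j , m) ≡ (σ′ , j′ , m′)
      edge {σ} {σ′} {j} {j′} {m} {m′} r p q = glue (δ-injective {σ} {σ′} d≡) (at-m r d≡ p)
        where
        d≡ : δ σ j ≡ δ σ′ j′
        d≡ = δ-≈⇒≡ {σ} {σ′} (at-step {m = m} {m′} r p q)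
        glue : (σ , j) ≡ (σ′ , j′) → m ≡ m′ → (σ , j , m) ≡ (σ′ , j′ , m′)
        glue refl refl = refl

-- The field of order nine and the initial designs

F₉ : Set
F₉ = Fin 3 × Fin 3

_⊕_ : Fin 3 → Fin 3 → Fin 3
0F ⊕ y = y
1F ⊕ y = next y
2F ⊕ y = next (next y)

⊖_ : Fin 3 → Fin 3
⊖ 0F = 0F
⊖ 1F = 2F
⊖ 2F = 1F

infixl 6 _+₉_
_+₉_ : F₉ → F₉ → F₉
(x , y) +₉ (x′ , y′) = (x ⊕ x′) , (y ⊕ y′)

-₉_ : F₉ → F₉
-₉ (x , y) = (⊖ x) , (⊖ y)

-- Multiplication by i, where F₉ = 𝔽₃[i] and (x , y) stands for x + y i.
i·_ : F₉ → F₉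
i· (x , y) = (⊖ y) , x

_≟₉_ : (x y : F₉) → Dec (x ≡ y)
_≟₉_ = ≡-dec Fin._≟_ Fin._≟_

-- Finiteness in a form that passes to products and sums, so that the small designs can be verified
-- by evaluation.
Exhaustible : Set → Set₁
Exhaustible A = ∀ {P : A → Set} → (∀ x → Dec (P x)) → Dec (∀ x → P x)

allBool? : Exhaustible Bool
allBool? P? = map′ (λ { (p , q) false → p ; (p , q) true → q }) (λ f → f false , f true)
                   (P? false ×-dec P? true)

all×? : ∀ {A B} → Exhaustible A → Exhaustible B → Exhaustible (A × B)
all×? allA? allB? P? = map′ (λ f (x , y) → f x y) (λ f x y → f (x , y))
                            (allA? λ x → allB? λ y → P? (x , y))

all⊎? : ∀ {A B} → Exhaustible A → Exhaustible B → Exhaustible (A ⊎ B)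
all⊎? allA? allB? P? =
  map′ (λ { (f , g) (inj₁ x) → f x ; (f , g) (inj₂ y) → g y })
       (λ f → (λ x → f (inj₁ x)) , (λ y → f (inj₂ y)))
       (allA? (λ x → P? (inj₁ x)) ×-dec allB? (λ y → P? (inj₂ y)))

all₉? : Exhaustible F₉
all₉? = all×? all? all?

module NineFrame where
  -- One element of each pair ±d of nonzero elements of F₉.
  δ⁺ : Fin 4 → F₉
  δ⁺ 0F = 1F , 0F
  δ⁺ 1F = 0F , 1F
  δ⁺ 2F = 1F , 1F
  δ⁺ 3F = 1F , 2F

  δ : Bool → Fin 4 → F₉
  δ true  j = δ⁺ j
  δ false j = -₉ δ⁺ j

  -- In characteristic 3 the choice α = 2 fails because α + 1 = 0; α = i works, since i, i + 1 and i
  -- - 1 are all nonzero.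
  coeff· : Fin 3 → F₉ → F₉
  coeff· 0F d = -₉ d
  coeff· 1F d = d
  coeff· 2F d = i· d

  place : Bool → Fin 4 → F₉ → Fin 3 → F₉
  place σ j m r = m +₉ coeff· r (δ σ j)

  place-edge : ∀ σ σ′ j j′ m m′ r → place σ j m r ≡ place σ′ j′ m′ r →
               place σ j m (next r) ≡ place σ′ j′ m′ (next r) →
               (σ , j , m) ≡ (σ′ , j′ , m′)
  place-edge = from-yes (allBool? λ σ → allBool? λ σ′ → all? λ j → all? λ j′ → all₉? λ m → all₉? λ m′ →
    all? λ r → (place σ j m r ≟₉ place σ′ j′ m′ r) →-dec
      ((place σ j m (next r) ≟₉ place σ′ j′ m′ (next r)) →-dec
        ≡-dec Bool._≟_ (≡-dec Fin._≟_ _≟₉_) (σ , j , m) (σ′ , j′ , m′)))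

  place-irrefl : ∀ σ j m r → place σ j m r ≢ place σ j m (next r)
  place-irrefl = from-yes (allBool? λ σ → all? λ j → all₉? λ m → all? λ r →
    ¬? (place σ j m r ≟₉ place σ j m (next r)))

  place-m : ∀ j m m′ r → place false j m r ≡ place false j m′ r → m ≡ m′
  place-m = from-yes (all? λ j → all₉? λ m → all₉? λ m′ → all? λ r →
    (place false j m r ≟₉ place false j m′ r) →-dec (m ≟₉ m′))

  place-j : ∀ j j′ m r → place true j m r ≡ place true j′ m r → j ≡ j′
  place-j = from-yes (all? λ j → all? λ j′ → all₉? λ m → all? λ r →
    (place true j m r ≟₉ place true j′ m r) →-dec (j Fin.≟ j′))

  place≢m : ∀ j m r → place true j m r ≢ m
  place≢m = from-yes (all? λ j → all₉? λ m → all? λ r → ¬? (place true j m r ≟₉ m))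

  place-opp : ∀ j j′ m → place true j m 0F ≢ place true j′ m 1F
  place-opp = from-yes (all? λ j → all? λ j′ → all₉? λ m →
    ¬? (place true j m 0F ≟₉ place true j′ m 1F))

  place-asym : ∀ j j′ m → place true j′ (place true j m 2F) 2F ≢ m
  place-asym = from-yes (all? λ j → all? λ j′ → all₉? λ m →
    ¬? (place true j′ (place true j m 2F) 2F ≟₉ m))

  frame : Frame F₉ 4
  frame = record
    { place        = place
    ; place-irrefl = place-irrefl
    ; place-edge   = λ r e e′ → place-edge _ _ _ _ _ _ r e e′
    ; place-m      = λ { {j} r refl e → place-m j _ _ r e }
    ; place-j      = λ { {j} {j′} {m} r refl e → place-j j j′ m r e }
    ; place≢m      = λ {j} {m} r e → place≢m j m r e
    ; place-opp    = λ { {j} {j′} {m} refl e → place-opp j j′ m e }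
    ; place-asym   = λ { {j} {j′} {m} refl e → place-asym j j′ m e }
    }

module Exhaustion
  {X N I : Set} (allX? : Exhaustible X) (allN? : Exhaustible N) (allI? : Exhaustible I)
  (_≟X_ : DecidableEquality X) (_≟N_ : DecidableEquality N) (_≟I_ : DecidableEquality I)
  (pt : I → Fin 3 → X) (centre : I → X ⊎ N) (slot : I → Fin 3 → Fin 3) where

  _≟C_ : DecidableEquality (X ⊎ N)
  _≟C_ = Sum.≡-dec _≟X_ _≟N_

  ptIrrefl? : Dec (∀ i r → pt i r ≢ pt i (next r))
  ptIrrefl? = allI? λ i → all? λ r → ¬? (pt i r ≟X pt i (next r))

  edgeInj? : Dec (∀ i j r r′ → pt i r ≡ pt j r′ → pt i (next r) ≡ pt j (next r′) → i ≡ j)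
  edgeInj? = allI? λ i → allI? λ j → all? λ r → all? λ r′ →
    (pt i r ≟X pt j r′) →-dec ((pt i (next r) ≟X pt j (next r′)) →-dec (i ≟I j))

  -- The centre of each block is tested before anything further is enumerated, which cuts the search
  -- short; `build` restores the order of the arguments.
  arcInj? : Dec (∀ i c → centre i ≡ inj₁ c → ∀ j → centre j ≡ inj₁ c →
                 ∀ r r′ → pt i r ≡ pt j r′ → i ≡ j)
  arcInj? = allI? λ i → allX? λ c → (centre i ≟C inj₁ c) →-dec
    (allI? λ j → (centre j ≟C inj₁ c) →-dec
    (all? λ r → all? λ r′ → (pt i r ≟X pt j r′) →-dec (i ≟I j)))

  arcAsym? : Dec (∀ i j r r′ → centre i ≡ inj₁ (pt j r′) → centre j ≢ inj₁ (pt i r))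
  arcAsym? = allI? λ i → allI? λ j → all? λ r → all? λ r′ →
    (centre i ≟C inj₁ (pt j r′)) →-dec ¬? (centre j ≟C inj₁ (pt i r))

  outerInj? : Dec (∀ i ν → centre i ≡ inj₂ ν → ∀ j → centre j ≡ inj₂ ν →
                   ∀ r r′ → pt i r ≡ pt j r′ → slot i r ≡ slot j r′ → i ≡ j)
  outerInj? = allI? λ i → allN? λ ν → (centre i ≟C inj₂ ν) →-dec
    (allI? λ j → (centre j ≟C inj₂ ν) →-dec
    (all? λ r → all? λ r′ → (pt i r ≟X pt j r′) →-dec ((slot i r Fin.≟ slot j r′) →-dec (i ≟I j))))

  build : True ptIrrefl? → True edgeInj? → True arcInj? → True arcAsym? → True outerInj? →
          NestedTriples X N I
  build p q s t u = record
    { pt = pt ; centre = centre ; slot = slot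
    ; pt-irrefl = toWitness p
    ; edge-inj  = toWitness q
    ; arc-inj   = λ i j r r′ e e′ → toWitness s i _ e j e′ r r′
    ; arc-asym  = toWitness t
    ; outer-inj = λ i j r r′ e e′ → toWitness u i _ e j e′ r r′
    }

-- The case u = 1: the only block in both cyclic orders, with the single new point as the centre of
-- both and one slot for each order.
triangle : NestedTriples (Fin 3 × Fin 1) (Fin 1) Bool
triangle = Exhaustion.build (all×? all? all?) all? allBool?
  (≡-dec Fin._≟_ Fin._≟_) Fin._≟_ Bool._≟_ pt (λ _ → inj₂ 0F) (λ i _ → if i then 0F else 1F)
  tt tt tt tt tt
  where
  pt : Bool → Fin 3 → Fin 3 × Fin 1
  pt true  r = r , 0F
  pt false r = (⊖ r) , 0F

-- The translates of the block {0, i, 1 − i}, in both cyclic orders and with 1 as the centre in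
-- one of them, together with the lines parallel to 𝔽₃.
nine : NestedTriples F₉ (Fin 2) (F₉ × Bool ⊎ Fin 3 × Bool)
nine = Exhaustion.build all₉? all? (all⊎? (all×? all₉? allBool?) (all×? all? allBool?))
  _≟₉_ Fin._≟_ (Sum.≡-dec (≡-dec _≟₉_ Bool._≟_) (≡-dec Fin._≟_ Bool._≟_)) pt centre slot
  tt tt tt tt tt
  where
  base : Fin 3 → F₉
  base 0F = 0F , 0F
  base 1F = 0F , 1F
  base 2F = 1F , 2F

  pt : F₉ × Bool ⊎ Fin 3 × Bool → Fin 3 → F₉
  pt (inj₁ (t , true))  r = t +₉ base r
  pt (inj₁ (t , false)) r = t +₉ base (⊖ r)
  pt (inj₂ (y , true))  r = r , y
  pt (inj₂ (y , false)) r = (⊖ r) , y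

  centre : F₉ × Bool ⊎ Fin 3 × Bool → F₉ ⊎ Fin 2
  centre (inj₁ (t , true))  = inj₁ (t +₉ (1F , 0F))
  centre (inj₁ (t , false)) = inj₂ 0F
  centre (inj₂ _)           = inj₂ 1F

  slot : F₉ × Bool ⊎ Fin 3 × Bool → Fin 3 → Fin 3
  slot (inj₁ _)           r = r
  slot (inj₂ (_ , true))  _ = 0F
  slot (inj₂ (_ , false)) _ = 1F

-- Nested designs of all orders

fin× : ∀ {m n} {A B : Set} → Fin m ↔ A → Fin n ↔ B → Fin (m * n) ↔ (A × B)
fin× {m} {n} f g = (f ×-↔ g) ↔-∘ *↔× {m} {n}

fin⊎ : ∀ {m n} {A B : Set} → Fin m ↔ A → Fin n ↔ B → Fin (m + n) ↔ (A ⊎ B)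
fin⊎ {m} {n} f g = (f ⊎-↔ g) ↔-∘ +↔⊎ {m} {n}

recount : ∀ {m n} {A : Set} → m ≡ n → Fin m ↔ A → Fin n ↔ A
recount eq = subst (λ n → Fin n ↔ _) eq

-- Here u = 2s + 1 and v = 6s + 3, and the number of blocks is v(v - 1)/3, as a (v,3,2)-BIBD
-- requires.
Nested : ℕ → Set
Nested s = NestedTriples (Fin 3 × Fin (suc (2 * s))) (Fin (suc s)) (Fin (suc (2 * s) * (6 * s + 2)))

nested-0 : Nested 0
nested-0 = relabel (↔⇒↣ (↔-id _)) (↔⇒↣ (↔-id _)) (↔⇒↣ 2↔Bool) triangle

nested-1 : Nested 1
nested-1 = relabel (↔⇒↣ (↔-id _)) (↔⇒↣ (↔-id _))
  (↔⇒↣ (fin⊎ (fin× (fin× (↔-id _) (↔-id _)) 2↔Bool) (fin× (↔-id _) 2↔Bool))) nine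

-- The parameter comes from (2h + 1)(2s + 1) = 2(h + s + 2hs) + 1.
inflation : ∀ {Q h s} → Frame Q h → Fin (suc (2 * h)) ↔ Q → Nested s → Nested (h + s + 2 * (h * s))
inflation {Q} {h} {s} F Q↔ D = relabel
  (↔⇒↣ (↔-id _ ×-↔ ↔-sym (recount (points h s) (fin× Q↔ (↔-id _)))))
  (↔⇒↣ (↔-sym (recount (outers h s) (fin⊎ (fin× (↔-id _) (↔-id _)) (↔-id _)))))
  (↔⇒↣ (recount (indices h s)
    (fin⊎ (fin× (fin× 2↔Bool (fin× (↔-id _) Q↔)) (fin× (↔-id _) (fin× (↔-id _) (↔-id _))))
          (fin× Q↔ (↔-id _)))))
  (Inflation.inflate F (Residues.squares s) D)
  where
  points : ∀ h s → suc (2 * h) * suc (2 * s) ≡ suc (2 * (h + s + 2 * (h * s)))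
  points = ℕ-Solver.solve-∀
  outers : ∀ h s → h * suc (2 * s) + suc s ≡ suc (h + s + 2 * (h * s))
  outers = ℕ-Solver.solve-∀
  indices : ∀ h s → (2 * (h * suc (2 * h))) * (3 * (suc (2 * s) * suc (2 * s))) +
                    suc (2 * h) * (suc (2 * s) * (6 * s + 2)) ≡
            suc (2 * (h + s + 2 * (h * s))) * (6 * (h + s + 2 * (h * s)) + 2)
  indices = ℕ-Solver.solve-∀

module _ where
  open import Data.Integer using (+_)

  Invertible6 : ℕ → Set
  Invertible6 h = ∀ {x} → + suc (2 * h) ∣ + 6 ℤ.* x → + suc (2 * h) ∣ x

  -- Here k = 6t + 1, so x = k x - t (6x).
  invert6-0 : ∀ t → Invertible6 (0 + t * 3)
  invert6-0 t {x} p =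
    subst (+ k ∣_) (trans (cong (λ z → z ℤ.* x ℤ.- + t ℤ.* (+ 6 ℤ.* x)) k≡) (lemma (+ t) x))
      (∣m∣n⇒∣m-n (∣m⇒∣m*n x (∣-refl {+ k})) (∣n⇒∣m*n (+ t) p))
    where
    k = suc (2 * (0 + t * 3))
    k≡ : + k ≡ + 1 ℤ.+ + 6 ℤ.* + t
    k≡ = trans (cong (λ n → + suc n) (flat t)) (cong (λ z → + 1 ℤ.+ z) (ℤₚ.pos-* 6 t))
      where
      flat : ∀ t → 2 * (0 + t * 3) ≡ 6 * t
      flat = ℕ-Solver.solve-∀
    lemma : ∀ t x → (+ 1 ℤ.+ + 6 ℤ.* t) ℤ.* x ℤ.- t ℤ.* (+ 6 ℤ.* x) ≡ x
    lemma = ℤ-Solver.solve-∀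

  -- Here k = 6t + 5, so x = (t + 1)(6x) - k x.
  invert6-2 : ∀ t → Invertible6 (2 + t * 3)
  invert6-2 t {x} p =
    subst (+ k ∣_) (trans (cong (λ z → (+ 1 ℤ.+ + t) ℤ.* (+ 6 ℤ.* x) ℤ.- z ℤ.* x) k≡) (lemma (+ t) x))
      (∣m∣n⇒∣m-n (∣n⇒∣m*n (+ 1 ℤ.+ + t) p) (∣m⇒∣m*n x (∣-refl {+ k})))
    where
    k = suc (2 * (2 + t * 3))
    k≡ : + k ≡ + 5 ℤ.+ + 6 ℤ.* + t
    k≡ = trans (cong +_ (flat t)) (cong (λ z → + 5 ℤ.+ z) (ℤₚ.pos-* 6 t))
      where
      flat : ∀ t → suc (2 * (2 + t * 3)) ≡ 5 + 6 * t
      flat = ℕ-Solver.solve-∀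
    lemma : ∀ t x → (+ 1 ℤ.+ t) ℤ.* (+ 6 ℤ.* x) ℤ.- (+ 5 ℤ.+ + 6 ℤ.* t) ℤ.* x ≡ x
    lemma = ℤ-Solver.solve-∀

-- Writing 2s + 1 = 3ᵉ m with 3 ∤ m, the factor 9 is split off as long as e ≥ 2, and for
-- e ≤ 1 the order-m frame is applied to the design with 3ᵉ fibres.
nested : ∀ s → Nested s
nested = <-rec Nested go
  where
  from-0 : ∀ h → Invertible6 h → Nested h
  from-0 h inv = subst Nested (eq h) (inflation (Residues.frame h inv) (↔-id _) nested-0)
    where
    eq : ∀ h → h + 0 + 2 * (h * 0) ≡ h
    eq = ℕ-Solver.solve-∀

  from-1 : ∀ h → Invertible6 h → Nested (1 + h * 3)
  from-1 h inv = subst Nested (eq h) (inflation (Residues.frame h inv) (↔-id _) nested-1)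
    where
    eq : ∀ h → h + 1 + 2 * (h * 1) ≡ 1 + h * 3
    eq = ℕ-Solver.solve-∀

  from-9 : ∀ t → Nested t → Nested (1 + (1 + t * 3) * 3)
  from-9 t D = subst Nested (eq t) (inflation NineFrame.frame (fin× {3} {3} (↔-id _) (↔-id _)) D)
    where
    eq : ∀ t → 4 + t + 2 * (4 * t) ≡ 1 + (1 + t * 3) * 3
    eq = ℕ-Solver.solve-∀

  smaller : ∀ t → t < 1 + (1 + t * 3) * 3
  smaller t = s≤s (ℕₚ.≤-trans (ℕₚ.m≤m*n t 3) (ℕₚ.≤-trans (ℕₚ.n≤1+n _) (ℕₚ.m≤m*n (1 + t * 3) 3)))

  go : ∀ s → (∀ {t} → t < s → Nested t) → Nested s
  go s rec with s divMod 3
  ... | result t 0F refl = from-0 (t * 3) (invert6-0 t)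
  ... | result t 2F refl = from-0 (2 + t * 3) (invert6-2 t)
  -- For s = 3h + 1 the order is 2s + 1 = 3(2h + 1), and for h = 3t + 1 it is 9(2t + 1).
  ... | result h 1F refl with h divMod 3
  ... | result t 0F refl = from-1 (t * 3) (invert6-0 t)
  ... | result t 1F refl = from-9 t (rec (smaller t))
  ... | result t 2F refl = from-1 (2 + t * 3) (invert6-2 t)

-- Double counting

sum-mono : ∀ {n} {f g : Fin n → ℕ} → (∀ i → f i ≤ g i) → sum f ≤ sum g
sum-mono {zero}  f≤g = z≤n
sum-mono {suc n} f≤g = ℕₚ.+-mono-≤ (f≤g zero) (sum-mono (f≤g ∘ suc))

sum-const : ∀ n c → ∑[ i < n ] c ≡ n * c
sum-const zero    c = refl
sum-const (suc n) c = cong (c +_) (sum-const n c)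

sum-+const : ∀ {n} (f : Fin n → ℕ) c → ∑[ i < n ] (f i + c) ≡ sum f + n * c
sum-+const {n} f c = trans (∑-distrib-+ f (λ _ → c)) (cong (sum f +_) (sum-const n c))

-- Outside index i the sum of f is at most that of g, so equal totals force g i ≤ f i.
sum-tight : ∀ {n} {f g : Fin n → ℕ} → (∀ i → f i ≤ g i) → sum f ≡ sum g → ∀ i → f i ≡ g i
sum-tight {suc n} {f} {g} f≤g eq i = ℕₚ.≤-antisym (f≤g i) (ℕₚ.+-cancelʳ-≤ (sum g′) (g i) (f i) (begin
  g i + sum g′  ≡⟨ sum-remove g ⟨
  sum g         ≡⟨ eq ⟨
  sum f         ≡⟨ sum-remove f ⟩
  f i + sum f′  ≤⟨ ℕₚ.+-monoʳ-≤ (f i) (sum-mono (f≤g ∘ punchIn i)) ⟩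
  f i + sum g′  ∎))
  where
  open ℕₚ.≤-Reasoning
  f′ g′ : Fin n → ℕ
  f′ = f ∘ punchIn i
  g′ = g ∘ punchIn i

-- The extra c on the left stands in for the exceptional index and avoids a factor n - 1.
sum-≤-except : ∀ {n} (f : Fin n → ℕ) x c → (∀ y → x ≢ y → f y ≤ c) → sum f + c ≤ f x + n * c
sum-≤-except {suc n} f x c f≤c = begin
  sum f + c                          ≡⟨ cong (_+ c) (sum-remove f) ⟩
  f x + sum (f ∘ punchIn x) + c      ≡⟨ ℕₚ.+-assoc (f x) _ c ⟩
  f x + (sum (f ∘ punchIn x) + c)    ≤⟨ ℕₚ.+-monoʳ-≤ (f x) (ℕₚ.+-monoˡ-≤ c
                                          (sum-mono (λ j → f≤c _ (≢-sym (Fin.punchInᵢ≢i x j))))) ⟩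
  f x + (∑[ j < n ] c + c)           ≡⟨ cong (λ z → f x + (z + c)) (sum-const n c) ⟩
  f x + (n * c + c)                  ≡⟨ cong (f x +_) (ℕₚ.+-comm (n * c) c) ⟩
  f x + suc n * c                    ∎
  where open ℕₚ.≤-Reasoning

sum-≡-except : ∀ {n} (f : Fin n → ℕ) x c → (∀ y → x ≢ y → f y ≡ c) → sum f + c ≡ f x + n * c
sum-≡-except {suc n} f x c f≡c = begin
  sum f + c                          ≡⟨ cong (_+ c) (sum-remove f) ⟩
  f x + sum (f ∘ punchIn x) + c      ≡⟨ ℕₚ.+-assoc (f x) _ c ⟩
  f x + (sum (f ∘ punchIn x) + c)    ≡⟨ cong (λ z → f x + (z + c))
                                          (trans (sum-cong-≗ (λ j → f≡c _ (≢-sym (Fin.punchInᵢ≢i x j))))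
                                                 (sum-const n c)) ⟩
  f x + (n * c + c)                  ≡⟨ cong (f x +_) (ℕₚ.+-comm (n * c) c) ⟩
  f x + suc n * c                    ∎
  where open ≡-Reasoning

𝟙 : ∀ {P : Set} → Dec P → ℕ
𝟙 d = if does d then 1 else 0

𝟙-yes : ∀ {P : Set} (d : Dec P) → P → 𝟙 d ≡ 1
𝟙-yes d p = cong (if_then 1 else 0) (dec-true d p)

𝟙-no : ∀ {P : Set} (d : Dec P) → ¬ P → 𝟙 d ≡ 0
𝟙-no d ¬p = cong (if_then 1 else 0) (dec-false d ¬p)

𝟙-× : ∀ {P Q : Set} (p : Dec P) (q : Dec Q) → 𝟙 (p ×-dec q) ≡ 𝟙 p * 𝟙 q
𝟙-× (yes _) (yes _) = refl
𝟙-× (yes _) (no _)  = refl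
𝟙-× (no _)  _       = refl

𝟙-idem : ∀ {P : Set} (d : Dec P) → 𝟙 d * 𝟙 d ≡ 𝟙 d
𝟙-idem (yes _) = refl
𝟙-idem (no _)  = refl

sum-point : ∀ {n} (z : Fin n) (g : Fin n → ℕ) → ∑[ y < n ] (𝟙 (z Fin.≟ y) * g y) ≡ g z
sum-point {n} z g = begin
  sum f         ≡⟨ ℕₚ.+-identityʳ _ ⟨
  sum f + 0     ≡⟨ sum-≡-except f z 0 (λ y z≢y → cong (_* g y) (𝟙-no (z Fin.≟ y) z≢y)) ⟩
  f z + n * 0   ≡⟨ cong₂ _+_ (cong (_* g z) (𝟙-yes (z Fin.≟ z) refl)) (ℕₚ.*-zeroʳ n) ⟩
  1 * g z + 0   ≡⟨ trans (ℕₚ.+-identityʳ _) (ℕₚ.*-identityˡ _) ⟩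
  g z           ∎
  where
  open ≡-Reasoning
  f : Fin n → ℕ
  f y = 𝟙 (z Fin.≟ y) * g y

-- Pigeonhole principle by induction on b: the code of a hit at index zero is removed from `Fin c`,
-- and the later codes avoid it.
count-≤ : ∀ {b c} {P : Fin b → Set} (P? : ∀ i → Dec (P i)) (code : ∀ i → P i → Fin c) →
          (∀ i j p q → code i p ≡ code j q → i ≡ j) → ∑[ i < b ] 𝟙 (P? i) ≤ c
count-≤ {zero}  P? code inj = z≤n
count-≤ {suc b} P? code inj with P? zero
... | no _ = count-≤ (P? ∘ suc) (code ∘ suc) (λ i j p q e → Fin.suc-injective (inj _ _ p q e))
... | yes p₀ = rest code inj
  where
  rest : ∀ {c} (code : ∀ i → _ → Fin c) → (∀ i j p q → code i p ≡ code j q → i ≡ j) →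
         suc (∑[ i < b ] 𝟙 (P? (suc i))) ≤ c
  rest {zero}  code inj with () ← code zero p₀
  rest {suc c} code inj = s≤s (count-≤ (P? ∘ suc) (λ i p → punchOut (fresh i p))
      (λ i j p q e → Fin.suc-injective (inj _ _ p q (Fin.punchOut-injective (fresh i p) (fresh j q) e))))
    where
    fresh : ∀ i p → code zero p₀ ≢ code (suc i) p
    fresh i p e with () ← inj _ _ p₀ p e

-- After the sums are exchanged, g y is counted once for each preimage of y, of which there is at
-- most one.
sum-injection : ∀ {v w} (ι : Fin v ↣ Fin w) (g : Fin w → ℕ) →
                ∑[ x < v ] g (Injection.to ι x) ≤ sum g
sum-injection {v} {w} ι g = begin
  ∑[ x < v ] g (to x)                                  ≡⟨ sum-cong-≗ (λ x → sum-point (to x) g) ⟨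
  ∑[ x < v ] ∑[ y < w ] (𝟙 (to x Fin.≟ y) * g y)       ≡⟨ ∑-comm (λ x y → 𝟙 (to x Fin.≟ y) * g y) ⟩
  ∑[ y < w ] ∑[ x < v ] (𝟙 (to x Fin.≟ y) * g y)       ≡⟨ sum-cong-≗ (λ y → *-distribʳ-sum (g y)
                                                              (λ x → 𝟙 (to x Fin.≟ y))) ⟨
  ∑[ y < w ] (∑[ x < v ] 𝟙 (to x Fin.≟ y) * g y)       ≤⟨ sum-mono (λ y → ℕₚ.*-monoˡ-≤ (g y)
                                                              (count-≤ {c = 1} (λ x → to x Fin.≟ y)
                                                                (λ _ _ → zero)
                                                                (λ i j p q _ → injective (trans p (sym q))))) ⟩
  ∑[ y < w ] (1 * g y)                                 ≡⟨ sum-cong-≗ (λ y → ℕₚ.*-identityˡ (g y)) ⟩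
  sum g                                                ∎
  where
  open ℕₚ.≤-Reasoning
  open Injection ι using (to; injective)

count-tabulate : ∀ {A : Set} {P : A → Set} (P? : ∀ a → Dec (P a)) {n} (f : Fin n → A) →
                 length (filter P? (tabulate f)) ≡ ∑[ i < n ] 𝟙 (P? (f i))
count-tabulate P? {zero}  f = refl
count-tabulate P? {suc n} f with P? (f zero)
... | yes _ = cong suc (count-tabulate P? (f ∘ suc))
... | no _  = count-tabulate P? (f ∘ suc)

pairCount-tabulate : ∀ {v b} (A : Fin b → Subset v) x y →
                     pairCount (tabulate A) x y ≡ ∑[ i < b ] (𝟙 (x ∈? A i) * 𝟙 (y ∈? A i))
pairCount-tabulate A x y =
  trans (count-tabulate (λ B → (x ∈? B) ×-dec (y ∈? B)) A)
        (sum-cong-≗ (λ i → 𝟙-× (x ∈? A i) (y ∈? A i)))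

∣∣-sum : ∀ {n} (p : Subset n) → ∣ p ∣ ≡ ∑[ x < n ] 𝟙 (x ∈? p)
∣∣-sum []          = refl
∣∣-sum (true  ∷ p) = cong suc (∣∣-sum p)
∣∣-sum (false ∷ p) = ∣∣-sum p

module Incidence {v b k} (A : Fin b → Subset v) (size : ∀ i → ∣ A i ∣ ≡ k) where
  private
    pc : Fin v → Fin v → ℕ
    pc = pairCount (tabulate A)

    m : Fin b → Fin v → ℕ
    m i x = 𝟙 (x ∈? A i)

    row : ∀ i → sum (m i) ≡ k
    row i = trans (sym (∣∣-sum (A i))) (size i)

  sum-incidence : ∑[ x < v ] ∑[ i < b ] 𝟙 (x ∈? A i) ≡ b * k
  sum-incidence = begin
    ∑[ x < v ] ∑[ i < b ] m i x  ≡⟨ ∑-comm (λ x i → m i x) ⟩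
    ∑[ i < b ] sum (m i)         ≡⟨ sum-cong-≗ row ⟩
    ∑[ i < b ] k                 ≡⟨ sum-const b k ⟩
    b * k                        ∎
    where open ≡-Reasoning

  sum-diagonal : ∑[ x < v ] pc x x ≡ b * k
  sum-diagonal = trans (sum-cong-≗ (λ x → trans (pairCount-tabulate A x x)
                                               (sum-cong-≗ (λ i → 𝟙-idem (x ∈? A i)))))
                       sum-incidence

  -- Ordered pairs are counted, diagonal included, so a block contributes k².
  sum-pairs : ∑[ x < v ] ∑[ y < v ] pc x y ≡ b * (k * k)
  sum-pairs = begin
    ∑[ x < v ] ∑[ y < v ] pc x y
      ≡⟨ sum-cong-≗ (λ x → sum-cong-≗ (λ y → pairCount-tabulate A x y)) ⟩
    ∑[ x < v ] ∑[ y < v ] ∑[ i < b ] (m i x * m i y)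
      ≡⟨ sum-cong-≗ (λ x → ∑-comm (λ y i → m i x * m i y)) ⟩
    ∑[ x < v ] ∑[ i < b ] ∑[ y < v ] (m i x * m i y)
      ≡⟨ ∑-comm (λ x i → ∑[ y < v ] (m i x * m i y)) ⟩
    ∑[ i < b ] ∑[ x < v ] ∑[ y < v ] (m i x * m i y)
      ≡⟨ sum-cong-≗ (λ i → sum-cong-≗ (λ x → sym (*-distribˡ-sum (m i x) (m i)))) ⟩
    ∑[ i < b ] ∑[ x < v ] (m i x * sum (m i))
      ≡⟨ sum-cong-≗ (λ i → sym (*-distribʳ-sum (sum (m i)) (m i))) ⟩
    ∑[ i < b ] (sum (m i) * sum (m i))
      ≡⟨ sum-cong-≗ (λ i → cong₂ _*_ (row i) (row i)) ⟩
    ∑[ i < b ] (k * k)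
      ≡⟨ sum-const b (k * k) ⟩
    b * (k * k) ∎
    where open ≡-Reasoning

  -- Equivalent to b k (k − 1) = v (v − 1) λ.
  balanced-size : ∀ {c} → (∀ x y → x ≢ y → pc x y ≡ c) → b * (k * k) + v * c ≡ b * k + v * (v * c)
  balanced-size {c} off = begin
    b * (k * k) + v * c                  ≡⟨ cong (_+ v * c) sum-pairs ⟨
    ∑[ x < v ] sum (pc x) + v * c        ≡⟨ sum-+const (λ x → sum (pc x)) c ⟨
    ∑[ x < v ] (sum (pc x) + c)          ≡⟨ sum-cong-≗ (λ x → sum-≡-except (pc x) x c (off x)) ⟩
    ∑[ x < v ] (pc x x + v * c)          ≡⟨ sum-+const (λ x → pc x x) (v * c) ⟩
    ∑[ x < v ] pc x x + v * (v * c)      ≡⟨ cong (_+ v * (v * c)) sum-diagonal ⟩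
    b * k + v * (v * c)                  ∎
    where open ≡-Reasoning

  -- The number of blocks already forces the total that exact balance would give, so no pair can
  -- fall short of c.
  balanced-of-≤ : ∀ {c} → b * (k * k) + v * c ≡ b * k + v * (v * c) →
                  (∀ x y → x ≢ y → pc x y ≤ c) → ∀ x y → x ≢ y → pc x y ≡ c
  balanced-of-≤ {c} total pc≤c x y x≢y = trans (pc≡t x y) (t-off x≢y)
    where
    -- The extremal table: the true count on the diagonal and c elsewhere. It dominates `pc` and has
    -- the same total.
    t : Fin v → Fin v → ℕ
    t x y = if does (x Fin.≟ y) then pc x y else c

    t-diag : ∀ x → t x x ≡ pc x x
    t-diag x = cong (if_then pc x x else c) (dec-true (x Fin.≟ x) refl)

    t-off : ∀ {x y} → x ≢ y → t x y ≡ c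
    t-off {x} {y} x≢y = cong (if_then pc x y else c) (dec-false (x Fin.≟ y) x≢y)

    pc≤t : ∀ x y → pc x y ≤ t x y
    pc≤t x y with x Fin.≟ y
    ... | yes _  = ℕₚ.≤-refl
    ... | no x≢y = pc≤c x y x≢y

    sum-t : ∑[ x < v ] sum (t x) + v * c ≡ b * k + v * (v * c)
    sum-t = begin
      ∑[ x < v ] sum (t x) + v * c     ≡⟨ sum-+const (λ x → sum (t x)) c ⟨
      ∑[ x < v ] (sum (t x) + c)       ≡⟨ sum-cong-≗ (λ x → trans
                                            (sum-≡-except (t x) x c (λ y x≢y → t-off x≢y))
                                            (cong (_+ v * c) (t-diag x))) ⟩
      ∑[ x < v ] (pc x x + v * c)      ≡⟨ sum-+const (λ x → pc x x) (v * c) ⟩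
      ∑[ x < v ] pc x x + v * (v * c)  ≡⟨ cong (_+ v * (v * c)) sum-diagonal ⟩
      b * k + v * (v * c)              ∎
      where open ≡-Reasoning

    sums : ∑[ x < v ] ∑[ y < v ] pc x y ≡ ∑[ x < v ] sum (t x)
    sums = ℕₚ.+-cancelʳ-≡ (v * c) _ _ (trans (cong (_+ v * c) sum-pairs) (trans total (sym sum-t)))

    pc≡t : ∀ x y → pc x y ≡ t x y
    pc≡t x = sum-tight (pc≤t x) (sum-tight (λ x → sum-mono (pc≤t x)) sums x)

-- The lower bound

does-true⇒ : ∀ {P : Set} (d : Dec P) → does d ≡ true → P
does-true⇒ (yes p) _ = p

module _ {m n} (f : Fin m → Fin n) (A : Subset m) where
  private
    hit? : ∀ y → Dec (∃[ x ] (x ∈ A × f x ≡ y))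
    hit? y = any? (λ x → (x ∈? A) ×-dec (f x Fin.≟ y))

  ∈-image⁺ : ∀ {x} → x ∈ A → f x ∈ image f A
  ∈-image⁺ {x} x∈A = Vec.lookup⇒[]= (f x) _
    (trans (Vec.lookup∘tabulate _ (f x)) (dec-true (hit? (f x)) (x , x∈A , refl)))

  ∈-image⁻ : ∀ {y} → y ∈ image f A → ∃[ x ] (x ∈ A × f x ≡ y)
  ∈-image⁻ {y} y∈ = does-true⇒ (hit? y)
    (trans (sym (Vec.lookup∘tabulate _ y)) (Vec.[]=⇒lookup y∈))

𝟙-mono : ∀ {P Q : Set} (p : Dec P) (q : Dec Q) → (P → Q) → 𝟙 p ≤ 𝟙 q
𝟙-mono (yes p) q P→Q = ℕₚ.≤-reflexive (sym (𝟙-yes q (P→Q p)))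
𝟙-mono (no _)  q P→Q = z≤n

-- Meant for the three exclusive ways in which an augmented block contains two old points: an arc in
-- either direction, or the original block.
𝟙-disjoint : ∀ {P Q R S : Set} (p : Dec P) (q : Dec Q) (r : Dec R) (s : Dec S) →
             (P → ¬ Q) → (P → ¬ R) → (Q → ¬ R) → (P → S) → (Q → S) → (R → S) →
             𝟙 p + 𝟙 q + 𝟙 r ≤ 𝟙 s
𝟙-disjoint (yes p) q r s pq pr qr ps qs rs
  rewrite 𝟙-no q (pq p) | 𝟙-no r (pr p) | 𝟙-yes s (ps p) = ℕₚ.≤-refl
𝟙-disjoint (no _) (yes q) r s pq pr qr ps qs rs
  rewrite 𝟙-no r (qr q) | 𝟙-yes s (qs q) = ℕₚ.≤-refl
𝟙-disjoint (no _) (no _) r s pq pr qr ps qs rs = 𝟙-mono r s rs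

module LowerBound {v w} (D : BIBD v 3 2) (W : WeakNesting D w) where
  open BIBD D
  open WeakNesting W
  open Injection ι using (to; injective)
  open IsPartialBIBD isPartial using (packed)

  private
    b : ℕ
    b = length blocks

    A : Fin b → Subset v
    A = lookup blocks

    B : Fin b → Subset w
    B i = embeddedBlock i ∪ ⁅ φ i ⁆

    ∣A∣≡3 : ∀ i → ∣ A i ∣ ≡ 3
    ∣A∣≡3 i = All.lookup blockSize (∈-lookup i)

    pair? : ∀ {n} (y z : Fin n) (C : Subset n) → Dec (y ∈ C × z ∈ C)
    pair? y z C = (y ∈? C) ×-dec (z ∈? C)

    arc? : ∀ i x y → Dec (φ i ≡ y × x ∈ A i)
    arc? i x y = (φ i Fin.≟ y) ×-dec (x ∈? A i)

    arc : Fin v → Fin w → ℕ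
    arc x y = ∑[ i < b ] 𝟙 (arc? i x y)

    pairs-A : ∀ x y → x ≢ y → ∑[ i < b ] 𝟙 (pair? x y (A i)) ≡ 2
    pairs-A x y x≢y = trans (sym (count-tabulate (pair? x y) A))
      (trans (cong (λ L → pairCount L x y) (List.tabulate-lookup blocks)) (balanced x y x≢y))

    pairs-B : ∀ y z → y ≢ z → ∑[ i < b ] 𝟙 (pair? y z (B i)) ≤ 3
    pairs-B y z y≢z = subst (_≤ 3) (count-tabulate (pair? y z) B) (packed y z y≢z)

    embed : ∀ {i x} → x ∈ A i → to x ∈ B i
    embed x∈A = x∈p∪q⁺ (inj₁ (∈-image⁺ to _ x∈A))

    new : ∀ {i y} → φ i ≡ y → y ∈ B i
    new refl = x∈p∪q⁺ (inj₂ (x∈⁅x⁆ _))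

    centre∉ : ∀ {i x} → φ i ≡ to x → ¬ x ∈ A i
    centre∉ {i} e x∈A = φ∉block i (subst (_∈ embeddedBlock i) (sym e) (∈-image⁺ to _ x∈A))

    -- The count 3b = v(v - 1) for k = 3 and λ = 2, free of subtraction.
    design-size : b * 3 + v ≡ v * v
    design-size = ℕₚ.*-cancelˡ-≡ _ _ 2 (ℕₚ.+-cancelˡ-≡ (b * 3) _ _ (begin
      b * 3 + 2 * (b * 3 + v)  ≡⟨ l b v ⟩
      b * (3 * 3) + v * 2      ≡⟨ Incidence.balanced-size A ∣A∣≡3 off ⟩
      b * 3 + v * (v * 2)      ≡⟨ r b v ⟩
      b * 3 + 2 * (v * v)      ∎))
      where
      open ≡-Reasoning
      l : ∀ b v → b * 3 + 2 * (b * 3 + v) ≡ b * (3 * 3) + v * 2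
      l = ℕ-Solver.solve-∀
      r : ∀ b v → b * 3 + v * (v * 2) ≡ b * 3 + 2 * (v * v)
      r = ℕ-Solver.solve-∀
      off : ∀ x y → x ≢ y → pairCount (tabulate A) x y ≡ 2
      off x y x≢y = trans (cong (λ L → pairCount L x y) (List.tabulate-lookup blocks)) (balanced x y x≢y)

    -- A block has one centre, hence one arc from each of its three points.
    arc-total : ∑[ x < v ] ∑[ y < w ] arc x y ≡ b * 3
    arc-total = trans (sum-cong-≗ per-point) (Incidence.sum-incidence A ∣A∣≡3)
      where
      open ≡-Reasoning
      per-point : ∀ x → ∑[ y < w ] arc x y ≡ ∑[ i < b ] 𝟙 (x ∈? A i)
      per-point x = begin
        ∑[ y < w ] ∑[ i < b ] 𝟙 (arc? i x y)
          ≡⟨ ∑-comm (λ y i → 𝟙 (arc? i x y)) ⟩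
        ∑[ i < b ] ∑[ y < w ] 𝟙 (arc? i x y)
          ≡⟨ sum-cong-≗ (λ i → sum-cong-≗ (λ y → 𝟙-× (φ i Fin.≟ y) (x ∈? A i))) ⟩
        ∑[ i < b ] ∑[ y < w ] (𝟙 (φ i Fin.≟ y) * 𝟙 (x ∈? A i))
          ≡⟨ sum-cong-≗ (λ i → sum-point (φ i) (λ _ → 𝟙 (x ∈? A i))) ⟩
        ∑[ i < b ] 𝟙 (x ∈? A i) ∎

    arc-self : ∀ x → arc x (to x) ≡ 0
    arc-self x = begin
      ∑[ i < b ] 𝟙 (arc? i x (to x))  ≡⟨ sum-cong-≗ (λ i → 𝟙-no (arc? i x (to x))
                                            (λ (e , x∈A) → centre∉ e x∈A)) ⟩
      ∑[ i < b ] 0                    ≡⟨ sum-const b 0 ⟩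
      b * 0                           ≡⟨ ℕₚ.*-zeroʳ b ⟩
      0                               ∎
      where open ≡-Reasoning

    arc≤3 : ∀ x y → arc x y ≤ 3
    arc≤3 x y with to x Fin.≟ y
    -- `packed` speaks of distinct points only; here the count is 0, because a centre avoids its
    -- block.
    ... | yes refl = subst (_≤ 3) (sym (arc-self x)) z≤n
    ... | no ιx≢y  = ℕₚ.≤-trans
      (sum-mono (λ i → 𝟙-mono (arc? i x y) (pair? (to x) y (B i)) (λ (e , x∈A) → embed x∈A , new e)))
      (pairs-B (to x) y ιx≢y)

    -- Two of the at most three augmented blocks through the pair are taken by the design itself.
    arc-pair : ∀ x y → x ≢ y → arc x (to y) + arc y (to x) ≤ 1
    arc-pair x y x≢y = ℕₚ.+-cancelʳ-≤ 2 _ 1 (begin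
      arc x (to y) + arc y (to x) + 2
        ≡⟨ cong (arc x (to y) + arc y (to x) +_) (pairs-A x y x≢y) ⟨
      arc x (to y) + arc y (to x) + ∑[ i < b ] 𝟙 (pair? x y (A i))
        ≡⟨ cong (_+ ∑[ i < b ] 𝟙 (pair? x y (A i)))
             (∑-distrib-+ (λ i → 𝟙 (arc? i x (to y))) (λ i → 𝟙 (arc? i y (to x)))) ⟨
      ∑[ i < b ] (𝟙 (arc? i x (to y)) + 𝟙 (arc? i y (to x))) + ∑[ i < b ] 𝟙 (pair? x y (A i))
        ≡⟨ ∑-distrib-+ (λ i → 𝟙 (arc? i x (to y)) + 𝟙 (arc? i y (to x)))
             (λ i → 𝟙 (pair? x y (A i))) ⟨
      ∑[ i < b ] (𝟙 (arc? i x (to y)) + 𝟙 (arc? i y (to x)) + 𝟙 (pair? x y (A i)))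
        ≤⟨ sum-mono (λ i → 𝟙-disjoint (arc? i x (to y)) (arc? i y (to x)) (pair? x y (A i))
             (pair? (to x) (to y) (B i))
             (λ (e , _) (e′ , _) → x≢y (injective (trans (sym e′) e)))
             (λ (e , _) (_ , y∈A) → centre∉ e y∈A)
             (λ (e , _) (x∈A , _) → centre∉ e x∈A)
             (λ (e , x∈A) → embed x∈A , new e)
             (λ (e , y∈A) → new e , embed y∈A)
             (λ (x∈A , y∈A) → embed x∈A , embed y∈A)) ⟩
      ∑[ i < b ] 𝟙 (pair? (to x) (to y) (B i))
        ≤⟨ pairs-B (to x) (to y) (x≢y ∘ injective) ⟩
      3 ∎)
      where open ℕₚ.≤-Reasoning

    inner : ℕ
    inner = ∑[ x < v ] ∑[ y < v ] arc x (to y)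

    -- Twice `inner` adds up both directions over all ordered pairs, with at most 1 off the diagonal
    -- and 0 on it.
    inner-≤ : inner + inner + v ≤ v * v
    inner-≤ = begin
      inner + inner + v
        ≡⟨ cong (λ z → inner + z + v) (∑-comm (λ x y → arc x (to y))) ⟩
      inner + ∑[ x < v ] ∑[ y < v ] arc y (to x) + v
        ≡⟨ cong₂ _+_ (sym both) (sym (ℕₚ.*-identityʳ v)) ⟩
      ∑[ x < v ] ∑[ y < v ] both-ways x y + v * 1
        ≡⟨ sum-+const (λ x → sum (both-ways x)) 1 ⟨
      ∑[ x < v ] (∑[ y < v ] both-ways x y + 1)
        ≤⟨ sum-mono (λ x → sum-≤-except (both-ways x) x 1 (arc-pair x)) ⟩
      ∑[ x < v ] (both-ways x x + v * 1)
        ≡⟨ sum-cong-≗ (λ x → cong₂ _+_ (cong₂ _+_ (arc-self x) (arc-self x)) (ℕₚ.*-identityʳ v)) ⟩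
      ∑[ x < v ] v
        ≡⟨ sum-const v v ⟩
      v * v ∎
      where
      open ℕₚ.≤-Reasoning
      both-ways : Fin v → Fin v → ℕ
      both-ways x y = arc x (to y) + arc y (to x)
      both : ∑[ x < v ] ∑[ y < v ] both-ways x y ≡ inner + ∑[ x < v ] ∑[ y < v ] arc y (to x)
      both = trans (sum-cong-≗ (λ x → ∑-distrib-+ (λ y → arc x (to y)) (λ y → arc y (to x))))
                   (∑-distrib-+ (λ x → ∑[ y < v ] arc x (to y)) (λ x → ∑[ y < v ] arc y (to x)))

    -- The slack 3 − arc x y is nonnegative, so it sums to less over ι X than over Y.
    arc-row : ∀ x → sum (arc x) + v * 3 ≤ ∑[ y < v ] arc x (to y) + w * 3
    arc-row x = begin
      sum (arc x) + v * 3
        ≡⟨ cong (sum (arc x) +_) (complement (arc x ∘ to) (arc≤3 x ∘ to)) ⟨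
      sum (arc x) + (∑[ y < v ] slack (to y) + ∑[ y < v ] arc x (to y))
        ≤⟨ ℕₚ.+-monoʳ-≤ (sum (arc x)) (ℕₚ.+-monoˡ-≤ _ (sum-injection ι slack)) ⟩
      sum (arc x) + (sum slack + ∑[ y < v ] arc x (to y))
        ≡⟨ shuffle (sum (arc x)) (sum slack) (∑[ y < v ] arc x (to y)) ⟩
      ∑[ y < v ] arc x (to y) + (sum slack + sum (arc x))
        ≡⟨ cong (∑[ y < v ] arc x (to y) +_) (complement (arc x) (arc≤3 x)) ⟩
      ∑[ y < v ] arc x (to y) + w * 3 ∎
      where
      open ℕₚ.≤-Reasoning
      slack : Fin w → ℕ
      slack y = 3 ∸ arc x y
      complement : ∀ {n} (f : Fin n → ℕ) → (∀ i → f i ≤ 3) → ∑[ i < n ] (3 ∸ f i) + sum f ≡ n * 3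
      complement {n} f f≤3 = trans (sym (∑-distrib-+ (λ i → 3 ∸ f i) f))
        (trans (sum-cong-≗ (λ i → ℕₚ.m∸n+n≡m (f≤3 i))) (sum-const n 3))
      shuffle : ∀ a s c → a + (s + c) ≡ c + (s + a)
      shuffle = ℕ-Solver.solve-∀

    -- Each old point sends at most 3(w - v) arcs to new points; all other arcs are counted by
    -- `inner`.
    arcs-≤ : b * 3 + v * (v * 3) ≤ inner + v * (w * 3)
    arcs-≤ = begin
      b * 3 + v * (v * 3)                              ≡⟨ cong (_+ v * (v * 3)) arc-total ⟨
      ∑[ x < v ] sum (arc x) + v * (v * 3)             ≡⟨ sum-+const (λ x → sum (arc x)) (v * 3) ⟨
      ∑[ x < v ] (sum (arc x) + v * 3)                 ≤⟨ sum-mono arc-row ⟩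
      ∑[ x < v ] (∑[ y < v ] arc x (to y) + w * 3)     ≡⟨ sum-+const (λ x → ∑[ y < v ] arc x (to y)) (w * 3) ⟩
      inner + v * (w * 3)                              ∎
      where open ℕₚ.≤-Reasoning

  -- Doubling `arcs-≤` makes `inner-≤` applicable, and `design-size` replaces 3b by v² - v; then v²
  -- and a factor v cancel.
  weak-nesting-bound : .{{ℕ.NonZero v}} → 7 * v ≤ 6 * w + 1
  weak-nesting-bound = ℕₚ.*-cancelˡ-≤ v (ℕₚ.+-cancelˡ-≤ (v * v) _ _ (begin
    v * v + v * (7 * v)                         ≡⟨ l₁ v ⟩
    2 * (v * v) + v * (v * 6)                   ≡⟨ cong (λ z → 2 * z + v * (v * 6)) design-size ⟨
    2 * (b * 3 + v) + v * (v * 6)               ≡⟨ l₂ (b * 3) v ⟩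
    2 * (b * 3 + v * (v * 3)) + 2 * v           ≤⟨ ℕₚ.+-monoˡ-≤ (2 * v) (ℕₚ.*-monoʳ-≤ 2 arcs-≤) ⟩
    2 * (inner + v * (w * 3)) + 2 * v           ≡⟨ l₃ inner v w ⟩
    (inner + inner + v) + v * (6 * w + 1)       ≤⟨ ℕₚ.+-monoˡ-≤ _ inner-≤ ⟩
    v * v + v * (6 * w + 1)                     ∎))
    where
    open ℕₚ.≤-Reasoning
    l₁ : ∀ v → v * v + v * (7 * v) ≡ 2 * (v * v) + v * (v * 6)
    l₁ = ℕ-Solver.solve-∀
    l₂ : ∀ a v → 2 * (a + v) + v * (v * 6) ≡ 2 * (a + v * (v * 3)) + 2 * v
    l₂ = ℕ-Solver.solve-∀
    l₃ : ∀ a v w → 2 * (a + v * (w * 3)) + 2 * v ≡ (a + a + v) + v * (6 * w + 1)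
    l₃ = ℕ-Solver.solve-∀

-- From nested triples to block designs

∣p∪⁅x⁆∣ : ∀ {n} (p : Subset n) {x} → x ∉ p → ∣ p ∪ ⁅ x ⁆ ∣ ≡ suc ∣ p ∣
∣p∪⁅x⁆∣ (true  ∷ p) {zero}  x∉p = contradiction here x∉p
∣p∪⁅x⁆∣ (false ∷ p) {zero}  x∉p = cong (suc ∘ ∣_∣) (∪-identityʳ p)
∣p∪⁅x⁆∣ (true  ∷ p) {suc x} x∉p = cong suc (∣p∪⁅x⁆∣ p (x∉p ∘ there))
∣p∪⁅x⁆∣ (false ∷ p) {suc x} x∉p = ∣p∪⁅x⁆∣ p (x∉p ∘ there)

triple : ∀ {n} → (Fin 3 → Fin n) → Subset n
triple p = (⁅ p 0F ⁆ ∪ ⁅ p 1F ⁆) ∪ ⁅ p 2F ⁆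

∈-triple⁺ : ∀ {n} (p : Fin 3 → Fin n) r → p r ∈ triple p
∈-triple⁺ p 0F = x∈p∪q⁺ (inj₁ (x∈p∪q⁺ (inj₁ (x∈⁅x⁆ _))))
∈-triple⁺ p 1F = x∈p∪q⁺ (inj₁ (x∈p∪q⁺ (inj₂ (x∈⁅x⁆ _))))
∈-triple⁺ p 2F = x∈p∪q⁺ (inj₂ (x∈⁅x⁆ _))

∈-triple⁻ : ∀ {n} (p : Fin 3 → Fin n) {x} → x ∈ triple p → ∃[ r ] p r ≡ x
∈-triple⁻ p x∈ with x∈p∪q⁻ _ _ x∈
... | inj₂ x∈₂ = 2F , sym (x∈⁅y⁆⇒x≡y _ x∈₂)
... | inj₁ x∈₀₁ with x∈p∪q⁻ _ _ x∈₀₁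
... | inj₁ x∈₀ = 0F , sym (x∈⁅y⁆⇒x≡y _ x∈₀)
... | inj₂ x∈₁ = 1F , sym (x∈⁅y⁆⇒x≡y _ x∈₁)

∣triple∣ : ∀ {n} (p : Fin 3 → Fin n) → (∀ r → p r ≢ p (next r)) → ∣ triple p ∣ ≡ 3
∣triple∣ p irr = begin
  ∣ (⁅ p 0F ⁆ ∪ ⁅ p 1F ⁆) ∪ ⁅ p 2F ⁆ ∣  ≡⟨ ∣p∪⁅x⁆∣ _ p₂∉ ⟩
  suc ∣ ⁅ p 0F ⁆ ∪ ⁅ p 1F ⁆ ∣          ≡⟨ cong suc (∣p∪⁅x⁆∣ _ (λ p₁∈ → irr 0F (sym (x∈⁅y⁆⇒x≡y _ p₁∈)))) ⟩
  2 + ∣ ⁅ p 0F ⁆ ∣                     ≡⟨ cong (2 +_) (∣⁅x⁆∣≡1 (p 0F)) ⟩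
  3                                    ∎
  where
  open ≡-Reasoning
  p₂∉ : p 2F ∉ ⁅ p 0F ⁆ ∪ ⁅ p 1F ⁆
  p₂∉ p₂∈ with x∈p∪q⁻ _ _ p₂∈
  ... | inj₁ q = irr 2F (x∈⁅y⁆⇒x≡y _ q)
  ... | inj₂ q = irr 1F (sym (x∈⁅y⁆⇒x≡y _ q))

image-triple : ∀ {m n} (f : Fin m → Fin n) (p : Fin 3 → Fin m) → image f (triple p) ≡ triple (f ∘ p)
image-triple f p = ⊆-antisym to from
  where
  to : image f (triple p) ⊆ triple (f ∘ p)
  to y∈ with ∈-image⁻ f (triple p) y∈
  ... | x , x∈ , refl with ∈-triple⁻ p x∈
  ... | r , refl = ∈-triple⁺ (f ∘ p) r
  from : triple (f ∘ p) ⊆ image f (triple p)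
  from y∈ with ∈-triple⁻ (f ∘ p) y∈
  ... | r , refl = ∈-image⁺ f (triple p) (∈-triple⁺ p r)

neighbours : ∀ r r′ → r ≢ r′ → next r ≡ r′ ⊎ next r′ ≡ r
neighbours 0F 0F r≢r′ = contradiction refl r≢r′
neighbours 0F 1F _ = inj₁ refl
neighbours 0F 2F _ = inj₂ refl
neighbours 1F 0F _ = inj₂ refl
neighbours 1F 1F r≢r′ = contradiction refl r≢r′
neighbours 1F 2F _ = inj₁ refl
neighbours 2F 0F _ = inj₁ refl
neighbours 2F 1F _ = inj₂ refl
neighbours 2F 2F r≢r′ = contradiction refl r≢r′

module Codes {X N I : Set} (D : NestedTriples X N I) where
  open NestedTriples D

  Edge : I → X → X → Set
  Edge i x y = ∃[ r ] (pt i r ≡ x × pt i (next r) ≡ y)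

  Arc : I → X → X ⊎ N → Set
  Arc i x z = ∃[ r ] (pt i r ≡ x × centre i ≡ z)

  -- The three ways for an augmented block to contain the pair y, z; for given y and z each
  -- of them occurs in at most one block.
  Code : I → X ⊎ N → X ⊎ N → Fin 3 → Set
  Code i (inj₁ x) (inj₁ y) 0F = Edge i x y
  Code i (inj₁ x) (inj₁ y) 1F = Edge i y x
  Code i (inj₁ x) (inj₁ y) 2F = Arc i x (inj₁ y) ⊎ Arc i y (inj₁ x)
  Code i (inj₁ x) (inj₂ ν) t  = ∃[ r ] (pt i r ≡ x × centre i ≡ inj₂ ν × slot i r ≡ t)
  Code i (inj₂ ν) (inj₁ x) t  = ∃[ r ] (pt i r ≡ x × centre i ≡ inj₂ ν × slot i r ≡ t)
  Code i (inj₂ _) (inj₂ _) t  = ⊥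

  edge-unique : ∀ {i j x y} → Edge i x y → Edge j x y → i ≡ j
  edge-unique (r , p , q) (r′ , p′ , q′) =
    edge-inj _ _ r r′ (trans p (sym p′)) (trans q (sym q′))

  code-unique : ∀ {i j} y z t → Code i y z t → Code j y z t → i ≡ j
  code-unique (inj₁ x) (inj₁ y) 0F c c′ = edge-unique c c′
  code-unique (inj₁ x) (inj₁ y) 1F c c′ = edge-unique c c′
  code-unique (inj₁ x) (inj₁ y) 2F (inj₁ (r , p , e)) (inj₁ (r′ , p′ , e′)) =
    arc-inj _ _ r r′ e e′ (trans p (sym p′))
  code-unique (inj₁ x) (inj₁ y) 2F (inj₂ (r , p , e)) (inj₂ (r′ , p′ , e′)) =
    arc-inj _ _ r r′ e e′ (trans p (sym p′))
  -- The two directions share the code `2F`, since `arc-asym` forbids opposite arcs.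
  code-unique (inj₁ x) (inj₁ y) 2F (inj₁ (r , refl , e)) (inj₂ (r′ , refl , e′)) =
    ⊥-elim (arc-asym _ _ r r′ e e′)
  code-unique (inj₁ x) (inj₁ y) 2F (inj₂ (r , refl , e)) (inj₁ (r′ , refl , e′)) =
    ⊥-elim (arc-asym _ _ r r′ e e′)
  code-unique (inj₁ x) (inj₂ ν) t (r , p , e , s) (r′ , p′ , e′ , s′) =
    outer-inj _ _ r r′ e e′ (trans p (sym p′)) (trans s (sym s′))
  code-unique (inj₂ ν) (inj₁ x) t (r , p , e , s) (r′ , p′ , e′ , s′) =
    outer-inj _ _ r r′ e e′ (trans p (sym p′)) (trans s (sym s′))

  Member : I → X ⊎ N → Set
  Member i y = (∃[ r ] inj₁ (pt i r) ≡ y) ⊎ centre i ≡ y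

  edge : ∀ i r r′ → pt i r ≢ pt i r′ → Edge i (pt i r) (pt i r′) ⊎ Edge i (pt i r′) (pt i r)
  edge i r r′ p≢ with neighbours r r′ (p≢ ∘ cong (pt i))
  ... | inj₁ refl = inj₁ (r , refl , refl)
  ... | inj₂ refl = inj₂ (r′ , refl , refl)

  code : ∀ i y z → y ≢ z → Member i y → Member i z → ∃[ t ] Code i y z t
  code i _ _ y≢z (inj₁ (r , refl)) (inj₁ (r′ , refl)) with edge i r r′ (y≢z ∘ cong inj₁)
  ... | inj₁ e = 0F , e
  ... | inj₂ e = 1F , e
  code i _ (inj₁ c) y≢z (inj₁ (r , refl)) (inj₂ e) = 2F , inj₁ (r , refl , e)
  code i _ (inj₂ ν) y≢z (inj₁ (r , refl)) (inj₂ e) = slot i r , r , refl , e , refl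
  code i (inj₁ c) _ y≢z (inj₂ e) (inj₁ (r , refl)) = 2F , inj₂ (r , refl , e)
  code i (inj₂ ν) _ y≢z (inj₂ e) (inj₁ (r , refl)) = slot i r , r , refl , e , refl
  code i _ _ y≢z (inj₂ e) (inj₂ e′) = contradiction (trans (sym e) e′) y≢z

module Realisation {v n b} (D : NestedTriples (Fin v) (Fin n) (Fin b)) (total : b * 3 + v ≡ v * v) where
  open NestedTriples D
  open Codes D

  block : Fin b → Subset v
  block i = triple (pt i)

  -- The two orientations of a pair give at most two blocks; `total`, which says 3b = v(v - 1),
  -- makes this exactly two.
  design : BIBD v 3 2
  design = record
    { blocks    = tabulate block
    ; blockSize = All.tabulate⁺ size
    ; balanced  = Incidence.balanced-of-≤ block size count at-most-two
    }
    where
    size : ∀ i → ∣ block i ∣ ≡ 3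
    size i = ∣triple∣ (pt i) (pt-irrefl i)

    count : b * (3 * 3) + v * 2 ≡ b * 3 + v * (v * 2)
    count = begin
      b * (3 * 3) + v * 2      ≡⟨ l b v ⟩
      b * 3 + 2 * (b * 3 + v)  ≡⟨ cong (λ z → b * 3 + 2 * z) total ⟩
      b * 3 + 2 * (v * v)      ≡⟨ r b v ⟩
      b * 3 + v * (v * 2)      ∎
      where
      open ≡-Reasoning
      l : ∀ b v → b * (3 * 3) + v * 2 ≡ b * 3 + 2 * (b * 3 + v)
      l = ℕ-Solver.solve-∀
      r : ∀ b v → b * 3 + 2 * (v * v) ≡ b * 3 + v * (v * 2)
      r = ℕ-Solver.solve-∀

    at-most-two : ∀ x y → x ≢ y → pairCount (tabulate block) x y ≤ 2
    at-most-two x y x≢y = subst (_≤ 2) (sym (count-tabulate both? block))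
        (count-≤ (both? ∘ block) (λ i p → orient (edges i p)) (λ i j p q → orient-inj (edges i p) (edges j q)))
      where
      both? : ∀ B → Dec (x ∈ B × y ∈ B)
      both? B = (x ∈? B) ×-dec (y ∈? B)
      edges : ∀ i → x ∈ block i × y ∈ block i → Edge i x y ⊎ Edge i y x
      edges i (x∈ , y∈) with ∈-triple⁻ (pt i) x∈ | ∈-triple⁻ (pt i) y∈
      ... | r , refl | r′ , refl = edge i r r′ x≢y
      orient : ∀ {P Q : Set} → P ⊎ Q → Fin 2
      orient (inj₁ _) = 0F
      orient (inj₂ _) = 1F
      orient-inj : ∀ {i j} (p : Edge i x y ⊎ Edge i y x) (q : Edge j x y ⊎ Edge j y x) →
                   orient p ≡ orient q → i ≡ j
      orient-inj (inj₁ p) (inj₁ q) _ = edge-unique p q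
      orient-inj (inj₂ p) (inj₂ q) _ = edge-unique p q

  nesting : WeakNesting design (v + n)
  nesting = record
    { ι         = ι
    ; φ         = φ
    ; φ∉block   = φ∉block
    ; isPartial = record { blockSize = All.tabulate⁺ size ; packed = packed }
    }
    where
    blocks : List (Subset v)
    blocks = tabulate block

    -- Centres are assigned to positions in the block list, whose length equals b only up to a
    -- proof.
    index : Fin (length blocks) → Fin b
    index = Fin.cast (List.length-tabulate block)

    index-injective : ∀ {i j} → index i ≡ index j → i ≡ j
    index-injective {i} {j} e = toℕ-injective
      (trans (sym (toℕ-cast _ i)) (trans (cong Fin.toℕ e) (toℕ-cast _ j)))

    lookup-block : ∀ i → lookup blocks i ≡ block (index i)
    lookup-block i = trans (cong (lookup blocks) (sym (cast-involutive (sym eq) eq i)))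
                           (List.lookup-tabulate block (index i))
      where
      eq : length blocks ≡ b
      eq = List.length-tabulate block

    ι : Fin v ↣ Fin (v + n)
    ι = mk↣ {to = _↑ˡ n} (↑ˡ-injective n _ _)

    φ : Fin (length blocks) → Fin (v + n)
    φ i = join v n (centre (index i))

    embedded : Fin (length blocks) → Subset (v + n)
    embedded i = image (_↑ˡ n) (lookup blocks i)

    embedded≡ : ∀ i → embedded i ≡ triple ((_↑ˡ n) ∘ pt (index i))
    embedded≡ i = trans (cong (image (_↑ˡ n)) (lookup-block i)) (image-triple (_↑ˡ n) (pt (index i)))

    ∈-embedded : ∀ {i y} → y ∈ embedded i → ∃[ r ] (pt (index i) r ↑ˡ n) ≡ y
    ∈-embedded {i} {y} y∈ = ∈-triple⁻ _ (subst (y ∈_) (embedded≡ i) y∈)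

    join-injective : ∀ {y z} → join v n y ≡ join v n z → y ≡ z
    join-injective {y} {z} e =
      trans (sym (splitAt-join v n y)) (trans (cong (splitAt v) e) (splitAt-join v n z))

    φ∉block : ∀ i → φ i ∉ embedded i
    φ∉block i φ∈ with ∈-embedded {i} φ∈
    -- A centre inside its own block would give an arc that is its own reverse.
    ... | r , e = arc-asym _ _ r r c c
      where
      c : centre (index i) ≡ inj₁ (pt (index i) r)
      c = join-injective (sym e)

    size : ∀ i → ∣ embedded i ∪ ⁅ φ i ⁆ ∣ ≡ 4
    size i = begin
      ∣ embedded i ∪ ⁅ φ i ⁆ ∣                ≡⟨ ∣p∪⁅x⁆∣ (embedded i) (φ∉block i) ⟩
      suc ∣ embedded i ∣                      ≡⟨ cong (suc ∘ ∣_∣) (embedded≡ i) ⟩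
      suc ∣ triple ((_↑ˡ n) ∘ pt (index i)) ∣ ≡⟨ cong suc (∣triple∣ _ (λ r →
                                                   pt-irrefl (index i) r ∘ ↑ˡ-injective n _ _)) ⟩
      4                                       ∎
      where open ≡-Reasoning

    augmented : Fin (length blocks) → Subset (v + n)
    augmented i = embedded i ∪ ⁅ φ i ⁆

    member : ∀ {i y} → y ∈ augmented i → Member (index i) (splitAt v y)
    member {i} {y} y∈ with x∈p∪q⁻ (embedded i) ⁅ φ i ⁆ y∈
    ... | inj₁ y∈A = let r , e = ∈-embedded {i} y∈A in
      inj₁ (r , trans (sym (splitAt-↑ˡ v _ n)) (cong (splitAt v) e))
    ... | inj₂ y∈φ =
      inj₂ (trans (sym (splitAt-join v n _)) (cong (splitAt v) (sym (x∈⁅y⁆⇒x≡y _ y∈φ))))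

    splitAt-injective : ∀ {y z} → splitAt v {n} y ≡ splitAt v z → y ≡ z
    splitAt-injective {y} {z} e =
      trans (sym (join-splitAt v n y)) (trans (cong (join v n) e) (join-splitAt v n z))

    packed : ∀ y z → y ≢ z → pairCount (tabulate augmented) y z ≤ 3
    packed y z y≢z = subst (_≤ 3) (sym (count-tabulate both? augmented))
        (count-≤ (both? ∘ augmented) (λ i p → proj₁ (codes i p)) unique)
      where
      both? : ∀ B → Dec (y ∈ B × z ∈ B)
      both? B = (y ∈? B) ×-dec (z ∈? B)
      codes : ∀ i → y ∈ augmented i × z ∈ augmented i →
              ∃[ t ] Code (index i) (splitAt v y) (splitAt v z) t
      codes i (y∈ , z∈) =
        code (index i) (splitAt v y) (splitAt v z) (y≢z ∘ splitAt-injective) (member {i} y∈) (member {i} z∈)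
      unique : ∀ i j p q → proj₁ (codes i p) ≡ proj₁ (codes j q) → i ≡ j
      unique i j p q e = index-injective (code-unique (splitAt v y) (splitAt v z) _
        (subst (Code (index i) (splitAt v y) (splitAt v z)) e (proj₂ (codes i p)))
        (proj₂ (codes j q)))

-- Existence and optimality for v ≡ 3 (mod 6)

theorem3p3 : ∀ (v : ℕ) → v % 6 ≡ 3 → v ≥ 9 →
    Σ[ D ∈ BIBD v 3 2 ] Σ[ N ∈ WeakNesting D ((7 * v + 3) / 6) ] Optimal N
theorem3p3 v v%6≡3 _ = existence v (v / 6) v≡
  where
  v≡ : v ≡ 3 * suc (2 * (v / 6))
  v≡ = trans (m≡m%n+[m/n]*n v 6) (trans (cong (_+ v / 6 * 6) v%6≡3) (eq (v / 6)))
    where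
    eq : ∀ s → 3 + s * 6 ≡ 3 * suc (2 * s)
    eq = ℕ-Solver.solve-∀

  -- Stated for arbitrary v so that v can be replaced by 3(2s + 1); then w = v + s + 1 = 7s + 4.
  existence : ∀ v s → v ≡ 3 * suc (2 * s) →
    Σ[ D ∈ BIBD v 3 2 ] Σ[ N ∈ WeakNesting D ((7 * v + 3) / 6) ] Optimal N
  existence v s refl = R.design , subst (WeakNesting R.design) w≡ R.nesting , optimal
    where
    total : ∀ s → suc (2 * s) * (6 * s + 2) * 3 + 3 * suc (2 * s) ≡
                  3 * suc (2 * s) * (3 * suc (2 * s))
    total = ℕ-Solver.solve-∀

    module R = Realisation
      (relabel (↔⇒↣ (↔-sym (*↔× {3} {suc (2 * s)}))) (↔⇒↣ (↔-id _)) (↔⇒↣ (↔-id _)) (nested s))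
      (total s)

    w≡ : 3 * suc (2 * s) + suc s ≡ (7 * (3 * suc (2 * s)) + 3) / 6
    w≡ = trans (sym (m*n/n≡m _ 6)) (cong (_/ 6) (eq s))
      where
      eq : ∀ s → (3 * suc (2 * s) + suc s) * 6 ≡ 7 * (3 * suc (2 * s)) + 3
      eq = ℕ-Solver.solve-∀

    optimal : ∀ D′ w′ → WeakNesting {3 * suc (2 * s)} {3} {2} D′ w′ → (7 * (3 * suc (2 * s)) + 3) / 6 ≤ w′
    -- As 6w = 7v + 3, an inequality w′ < w would give 6w′ + 7 ≤ 7v + 4 ≤ 6w′ + 5.
    optimal D′ w′ N′ = subst (_≤ w′) w≡ (ℕₚ.≮⇒≥ λ w′<w → ℕₚ.<-irrefl refl (begin-strict
      6 * w′ + 6 + 1                     ≡⟨ l w′ ⟩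
      6 * suc w′ + 1                     ≤⟨ ℕₚ.+-monoˡ-≤ 1 (ℕₚ.*-monoʳ-≤ 6 w′<w) ⟩
      6 * (3 * suc (2 * s) + suc s) + 1  ≡⟨ r s ⟩
      7 * (3 * suc (2 * s)) + 4          ≤⟨ ℕₚ.+-monoˡ-≤ 4 (LowerBound.weak-nesting-bound D′ N′) ⟩
      6 * w′ + 1 + 4                     ≡⟨ ℕₚ.+-assoc (6 * w′) 1 4 ⟩
      6 * w′ + 5                         <⟨ ℕₚ.+-monoʳ-< (6 * w′) {5} {7} (s≤s (s≤s (s≤s (s≤s (s≤s (s≤s z≤n)))))) ⟩
      6 * w′ + (6 + 1)                   ≡⟨ ℕₚ.+-assoc (6 * w′) 6 1 ⟨
      6 * w′ + 6 + 1                     ∎))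
      where
      open ℕₚ.≤-Reasoning
      l : ∀ w → 6 * w + 6 + 1 ≡ 6 * suc w + 1
      l = ℕ-Solver.solve-∀
      r : ∀ s → 6 * (3 * suc (2 * s) + suc s) + 1 ≡ 7 * (3 * suc (2 * s)) + 4
      r = ℕ-Solver.solve-∀
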